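{- Let $m\geqslant 1$, let $n_1,\ldots,n_{m}$ be positive integers, set $n_{m+1}=n_1$, and let $j,r$ be non-negative integers with $j\leqslant m$. Then \begin{align*} &\sum_{k=0}^{n_1} q^{j(k^2+k)-(r+1)k}[2k+1][k]^r[k+1]^r\prod_{i=1}^m {n_i+n_{i+1}+1\brack n_i-k} \\ &\equiv 0 \mod [n_1+n_m+1]{n_1+n_m\brack n_1}[n_1]^{\min\{1,r\}}[n_m]^{\min\{1,{r\choose 2}\}}, \end{align*} and \begin{align*} &\sum_{k=0}^{n_1}(-1)^k q^{{k\choose 2}+j(k^2+k)-rk} [2k+1][k]^r[k+1]^r\prod_{i=1}^m {n_i+n_{i+1}+1\brack n_i-k} \\ &\equiv 0 \mod [n_1+n_m+1]{n_1+n_m\brack n_1}[n_1]^{\min\{1,r\}}[n_m]^{\min\{1,r\}}. \end{align*}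
   Context: For a non-negative integer $n$, $[n]=1+q+\cdots+q^{n-1}$ (so $[0]=0$). The $q$-binomial coefficient is ${n\brack k}=\prod_{i=1}^k\frac{1-q^{n-i+1}}{1-q^i}$ if $k\geqslant 0$ and ${n\brack k}=0$ if $k<0$. For a polynomial $D$ in $q$ and Laurent polynomials $A,B$ in $q$, $A\equiv B \bmod D$ means that $(A-B)/D$ is a Laurent polynomial in $q$. -}

module Defs where

open import Data.Nat as ℕ using (ℕ; zero; suc)
open import Data.Nat.DivMod using (_%_; m%n<n)
open import Data.Integer as ℤ using (ℤ; +_; -[1+_]; _⊓_; ∣_∣)
open import Data.List using (List; []; _∷_; map; replicate; _++_)
open import Data.Fin using (Fin; zero; suc; toℕ; fromℕ; fromℕ<)
open import Data.Product using (Σ)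
open import Relation.Binary.PropositionalEquality using (_≡_)

-- Polynomials in q with integer coefficients: coefficient lists, lowest degree first.
Poly : Set
Poly = List ℤ

padd : Poly → Poly → Poly
padd [] p = p
padd (a ∷ p) [] = a ∷ p
padd (a ∷ p) (b ∷ p′) = (a ℤ.+ b) ∷ padd p p′

pscale : ℤ → Poly → Poly
pscale a = map (a ℤ.*_)

pmul : Poly → Poly → Poly
pmul [] p = []
pmul (a ∷ p) p′ = padd (pscale a p′) (+ 0 ∷ pmul p p′)

pshift : ℕ → Poly → Poly
pshift n p = replicate n (+ 0) ++ p

-- Laurent polynomials in q: q^sh · co(q)
record Laurent : Set where
  constructor lp
  field
    sh : ℤ
    co : Poly
open Laurent public

fromPoly : Poly → Laurent
fromPoly p = lp (+ 0) p

const : ℤ → Laurent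
const c = lp (+ 0) (c ∷ [])

qpow : ℤ → Laurent
qpow e = lp e (+ 1 ∷ [])

infixl 6 _⊕_ _⊝_
infixl 7 _⊗_
infixr 8 _^L_
infix 4 _≈L_ _≡_mod_

_⊕_ : Laurent → Laurent → Laurent
lp s p ⊕ lp t p′ =
  lp (s ⊓ t) (padd (pshift ∣ s ℤ.- (s ⊓ t) ∣ p) (pshift ∣ t ℤ.- (s ⊓ t) ∣ p′))

_⊗_ : Laurent → Laurent → Laurent
lp s p ⊗ lp t p′ = lp (s ℤ.+ t) (pmul p p′)

⊖_ : Laurent → Laurent
⊖ lp s p = lp s (pscale (ℤ.- + 1) p)

_⊝_ : Laurent → Laurent → Laurent
A ⊝ B = A ⊕ (⊖ B)

_^L_ : Laurent → ℕ → Laurent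
A ^L zero = const (+ 1)
A ^L suc n = A ⊗ (A ^L n)

nth : Poly → ℕ → ℤ
nth [] n = + 0
nth (a ∷ p) zero = a
nth (a ∷ p) (suc n) = nth p n

coeff : Laurent → ℤ → ℤ
coeff (lp s p) i with i ℤ.- s
... | + n = nth p n
... | -[1+ n ] = + 0

_≈L_ : Laurent → Laurent → Set
A ≈L B = ∀ i → coeff A i ≡ coeff B i

_≡_mod_ : Laurent → Laurent → Laurent → Set
A ≡ B mod D = Σ Laurent (λ C → (A ⊝ B) ≈L (C ⊗ D))

qint : ℕ → Laurent
qint n = fromPoly (replicate n (+ 1))

-- Gaussian binomial (n brack k) for k ≥ 0, via the q-Pascal recurrence
qbinP : ℕ → ℕ → Poly
qbinP n zero = + 1 ∷ []
qbinP zero (suc k) = []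
qbinP (suc n) (suc k) = padd (qbinP n k) (pshift (suc k) (qbinP n (suc k)))

qbin : ℕ → ℤ → Laurent
qbin n (+ k) = fromPoly (qbinP n k)
qbin n -[1+ k ] = const (+ 0)

sumTo : ℕ → (ℕ → Laurent) → Laurent
sumTo zero f = f 0
sumTo (suc n) f = sumTo n f ⊕ f (suc n)

prodFin : ∀ m → (Fin m → Laurent) → Laurent
prodFin zero f = const (+ 1)
prodFin (suc m) f = f zero ⊗ prodFin m (λ i → f (suc i))

nextFin : ∀ {m} → Fin (suc m) → Fin (suc m)
nextFin {m} i = fromℕ< (m%n<n (suc (toℕ i)) (suc m))

{-# OPTIONS --safe #-}

-- Write B(a,b;k) for the q-binomial (a+b+1 choose a-k), D(a,b) = [a+b+1](a+b choose a), and, for a weight w,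
-- A(n₁,…,nₘ) = Σₖ w(k) B(n₁,n₂;k) B(n₂,n₃;k) ⋯ B(nₘ,n₁;k).  The q-Chu-Vandermonde formula gives
--   q^(j(k²+k)) B(n₁,n₂;k) B(n₂,n₃;k) B(nₘ,n₁;k) = Σₛ κ(s) B(n₁,nₘ;s) B(n₂,n₃;s) · B(s,n₃;k) B(nₘ,s;k)
-- for j = 1 with κ(s) = q^(s²+s), and for j = 0 with κ(s) = q^((n₁-s)(n₂-s)).  Summed against w it expresses
-- A(n₁,n₂,n₃,…,nₘ) through the sums A(s,n₃,…,nₘ), at the cost of at most one factor q^(k²+k), and
-- B(a,z;s) D(s,z) = D(a,z) (a choose s) carries the divisibility along.  This reduces to m = 1 and j ≤ 1.  There
-- [k][k+1]q^(-k) = q^(-n) ([n][n+1] - [n-k][n+k+1]) gives a recurrence in r, and the sums for r = 0 telescope.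
module Submission where

open import Defs
open import Algebra.Bundles using (CommutativeRing)
open import Data.Fin as Fin using (Fin)
import Data.Fin.Properties as Fin
open import Data.Integer as ℤ using (ℤ; +_; -[1+_])
import Data.Integer.Properties as ℤ
open import Data.Integer.Tactic.RingSolver using (solve-∀)
open import Data.List using (List; []; _∷_; length; replicate; tabulate)
open import Data.List.Properties using (length-tabulate)
open import Data.Nat as ℕ using (ℕ; zero; suc; _≤_; _<_; _∸_; z≤n; s≤s)
open import Data.Nat.Combinatorics using (_C_; nCk+nC[k+1]≡[n+1]C[k+1]; nC1≡n)
open import Data.Nat.DivMod using (_%_; m%n<n; m<n⇒m%n≡m; n%n≡0)
import Data.Nat.Properties as ℕ
import Data.Nat.Tactic.RingSolver as ℕSolver
open import Data.Product using (_×_; _,_)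
open import Data.Sum using (inj₁; inj₂)
open import Level using (0ℓ)
open import Relation.Binary.PropositionalEquality as ≡ using (_≡_)

-- The calculus of q-integers in a commutative ring, with q = 1 + h

-- Once the factors at the two neighbours of the merged vertex are rewritten, s occurs only in κ(s)
-- (a+k+1 choose a-s)(b-k choose s-k), and κ is a power of q for which this sum closes. The two
-- forms of q-Chu-Vandermonde give the two choices of κ. Each merge removes one vertex and uses up
-- at most one unit of j, so j ≤ m leaves j ≤ 1 at m = 1.
--
-- The exponents in the moduli are decided at m = 1. The recurrence in r has two terms. One carries
-- [n]² D(n,n), because [2n+1][2n] D(n-1,n-1) = [n]² D(n,n); the other carries [n] times whatever
-- divides the sum for the previous r. Hence every step gains a factor [n], up to two. At r = 0 the
-- sums of the first congruence are D(n,n) times a unit, so the second [n] arrives at r = 2, which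
-- is the role of (r choose 2). The alternating sums with n ≥ 1 are divisible by D(n,n)[n] already
-- at r = 0, so r = 1 suffices.
--
-- No quotients are formed: identities are multiplied by q-factorials, which are then cancelled.

module QCalculus {c ℓ} (R : CommutativeRing c ℓ) (h : CommutativeRing.Carrier R) where

  open CommutativeRing R
  open import Algebra.Properties.Ring ring
    using (+-cancelʳ; x[y-z]≈xy-xz; x∙y⁻¹≈ε⇒x≈y; -‿distribˡ-*; +-inverseˡ-unique)
  open import Algebra.Properties.CommutativeSemiring.Exp commutativeSemiring
    using (_^_; ^-homo-*; ^-congʳ; ^-congˡ; ^-assocʳ; ^-distrib-*)
  open import Algebra.Properties.Semiring.Divisibility semiring
    using (_∣_; _,_; _∣0; 1∣_; ∣ʳ-respʳ-≈; ∣ʳ-respˡ-≈; ∣ʳ-refl; ∣ʳ-trans; x∣ʳy⇒x∣ʳzy; ∣ʳ-reflexive)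
  open import Algebra.Properties.CommutativeSemigroup.Divisibility *-commutativeSemigroup
    using (∙-cong-∣)
  open import Algebra.Solver.Ring.NaturalCoefficients.Default commutativeSemiring
  open import Relation.Binary.Reasoning.Setoid setoid

  q : Carrier
  q = 1# + h

  [_] : ℕ → Carrier
  [ zero ] = 0#
  [ suc n ] = 1# + q * [ n ]

  fac : ℕ → Carrier
  fac zero = 1#
  fac (suc n) = [ suc n ] * fac n

  bin : ℕ → ℕ → Carrier
  bin n zero = 1#
  bin zero (suc k) = 0#
  bin (suc n) (suc k) = bin n k + q ^ suc k * bin n (suc k)

  choose : ℕ → ℕ → Carrier
  choose a b = bin (a ℕ.+ b) a

  []-cong : ∀ {m n} → m ≡ n → [ m ] ≈ [ n ]
  []-cong e = reflexive (≡.cong [_] e)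

  []-+ : ∀ m n → [ m ℕ.+ n ] ≈ [ m ] + [ n ] + h * ([ m ] * [ n ])
  []-+ zero n = solve 2 (λ h b → b := con 0 :+ b :+ h :* (con 0 :* b)) refl h [ n ]
  []-+ (suc m) n = trans (+-congˡ (*-congˡ ([]-+ m n)))
    (solve 3 (λ h a b → con 1 :+ (con 1 :+ h) :* (a :+ b :+ h :* (a :* b))
      := (con 1 :+ (con 1 :+ h) :* a) :+ b :+ h :* ((con 1 :+ (con 1 :+ h) :* a) :* b)) refl h [ m ] [ n ])

  -- The subtraction-free form of (q - 1)[n] = q^n - 1. With it and `[]-+`, identities in powers of
  -- q and q-integers become polynomial identities with natural coefficients.
  q^ : ∀ n → q ^ n ≈ 1# + h * [ n ]
  q^ zero = solve 1 (λ h → con 1 := con 1 :+ h :* con 0) refl h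
  q^ (suc n) = trans (*-congˡ (q^ n))
    (solve 2 (λ h a → (con 1 :+ h) :* (con 1 :+ h :* a) := con 1 :+ h :* (con 1 :+ (con 1 :+ h) :* a)) refl h [ n ])

  bin-zero : ∀ {n k} → n < k → bin n k ≈ 0#
  bin-zero {zero} (s≤s _) = refl
  bin-zero {suc n} {suc k} (s≤s n<k) = begin
    bin n k + q ^ suc k * bin n (suc k)   ≈⟨ +-cong (bin-zero n<k) (*-congˡ (bin-zero (ℕ.m<n⇒m<1+n n<k))) ⟩
    0# + q ^ suc k * 0#                   ≈⟨ trans (+-identityˡ _) (zeroʳ _) ⟩
    0#                                    ∎

  bin-self : ∀ n → bin n n ≈ 1#
  bin-self zero = refl
  bin-self (suc n) = begin
    bin n n + q ^ suc n * bin n (suc n)   ≈⟨ +-cong (bin-self n) (*-congˡ (bin-zero (ℕ.n<1+n n))) ⟩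
    1# + q ^ suc n * 0#                   ≈⟨ trans (+-congˡ (zeroʳ _)) (+-identityʳ _) ⟩
    1#                                    ∎

  -- The q-Pascal rule reduces the claim to [a+b+2] = [a+1] + q^(a+1) [b+1]. This product form takes
  -- the place of the quotient of factorials in all later binomial identities.
  choose-fac : ∀ a b → choose a b * (fac a * fac b) ≈ fac (a ℕ.+ b)
  choose-fac zero b = trans (*-identityˡ _) (*-identityˡ _)
  choose-fac (suc a) zero = begin
    bin (suc a ℕ.+ 0) (suc a) * (fac (suc a) * 1#)
      ≈⟨ *-cong (trans (reflexive (≡.cong (λ x → bin x (suc a)) (ℕ.+-identityʳ (suc a)))) (bin-self (suc a))) (*-identityʳ _) ⟩
    1# * fac (suc a)      ≈⟨ *-identityˡ _ ⟩
    fac (suc a)           ≡⟨ ≡.cong fac (≡.sym (ℕ.+-identityʳ (suc a))) ⟩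
    fac (suc a ℕ.+ 0)     ∎
  choose-fac (suc a) (suc b) = begin
    (X + q ^ suc a * Y) * (([ suc a ] * fac a) * ([ suc b ] * fac b))
      ≈⟨ solve 7 (λ x y Q a′ b′ fa fb → (x :+ Q :* y) :* ((a′ :* fa) :* (b′ :* fb))
           := a′ :* (x :* (fa :* (b′ :* fb))) :+ Q :* b′ :* (y :* ((a′ :* fa) :* fb))) refl
           X Y (q ^ suc a) [ suc a ] [ suc b ] (fac a) (fac b) ⟩
    [ suc a ] * (X * (fac a * fac (suc b))) + q ^ suc a * [ suc b ] * (Y * (fac (suc a) * fac b))
      ≈⟨ +-cong (*-congˡ (choose-fac a (suc b))) (*-cong (*-congʳ (q^ (suc a))) IH) ⟩
    [ suc a ] * F + (1# + h * [ suc a ]) * [ suc b ] * F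
      ≈⟨ solve 4 (λ h a′ b′ f → a′ :* f :+ (con 1 :+ h :* a′) :* b′ :* f := (a′ :+ b′ :+ h :* (a′ :* b′)) :* f)
           refl h [ suc a ] [ suc b ] F ⟩
    ([ suc a ] + [ suc b ] + h * ([ suc a ] * [ suc b ])) * F
      ≈⟨ *-congʳ ([]-+ (suc a) (suc b)) ⟨
    fac (suc a ℕ.+ suc b) ∎
    where
    X = bin (a ℕ.+ suc b) a
    Y = bin (a ℕ.+ suc b) (suc a)
    F = fac (a ℕ.+ suc b)
    IH : Y * (fac (suc a) * fac b) ≈ F
    IH = ≡.subst (λ n → bin n (suc a) * (fac (suc a) * fac b) ≈ fac n) (≡.sym (ℕ.+-suc a b)) (choose-fac (suc a) b)

  -- Finite sums

  ∑ : ℕ → (ℕ → Carrier) → Carrier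
  ∑ zero f = f 0
  ∑ (suc n) f = ∑ n f + f (suc n)

  ∑-cong : ∀ n {f g} → (∀ k → k ≤ n → f k ≈ g k) → ∑ n f ≈ ∑ n g
  ∑-cong zero e = e 0 z≤n
  ∑-cong (suc n) e = +-cong (∑-cong n (λ k k≤n → e k (ℕ.m≤n⇒m≤1+n k≤n))) (e (suc n) ℕ.≤-refl)

  ∑-zero : ∀ n {f} → (∀ k → k ≤ n → f k ≈ 0#) → ∑ n f ≈ 0#
  ∑-zero zero e = e 0 z≤n
  ∑-zero (suc n) e = trans (+-cong (∑-zero n (λ k k≤n → e k (ℕ.m≤n⇒m≤1+n k≤n))) (e (suc n) ℕ.≤-refl)) (+-identityˡ 0#)

  ∑-+ : ∀ n f g → ∑ n (λ k → f k + g k) ≈ ∑ n f + ∑ n g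
  ∑-+ zero f g = refl
  ∑-+ (suc n) f g = trans (+-congʳ (∑-+ n f g))
    (solve 4 (λ a b c d → (a :+ b) :+ (c :+ d) := (a :+ c) :+ (b :+ d)) refl _ _ _ _)

  ∑-*ˡ : ∀ n x f → ∑ n (λ k → x * f k) ≈ x * ∑ n f
  ∑-*ˡ zero x f = refl
  ∑-*ˡ (suc n) x f = trans (+-congʳ (∑-*ˡ n x f)) (sym (distribˡ x _ _))

  ∑-*ʳ : ∀ n x f → ∑ n (λ k → f k * x) ≈ ∑ n f * x
  ∑-*ʳ zero x f = refl
  ∑-*ʳ (suc n) x f = trans (+-congʳ (∑-*ʳ n x f)) (sym (distribʳ x _ _))

  ∑-head : ∀ n f → ∑ (suc n) f ≈ f 0 + ∑ n (λ k → f (suc k))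
  ∑-head zero f = refl
  ∑-head (suc n) f = trans (+-congʳ (∑-head n f)) (+-assoc _ _ _)

  ∑-rev : ∀ n f → ∑ n (λ k → f (n ∸ k)) ≈ ∑ n f
  ∑-rev zero f = refl
  ∑-rev (suc n) f = trans (∑-head n (λ k → f (suc n ∸ k))) (trans (+-congˡ (∑-rev n f)) (+-comm _ _))

  ∑-drop : ∀ k d f → (∀ s → s < k → f s ≈ 0#) → ∑ (k ℕ.+ d) f ≈ ∑ d (λ t → f (k ℕ.+ t))
  ∑-drop zero d f e = refl
  ∑-drop (suc k) d f e = begin
    ∑ (suc (k ℕ.+ d)) f                       ≈⟨ ∑-head (k ℕ.+ d) f ⟩
    f 0 + ∑ (k ℕ.+ d) (λ s → f (suc s))       ≈⟨ trans (+-congʳ (e 0 (s≤s z≤n))) (+-identityˡ _) ⟩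
    ∑ (k ℕ.+ d) (λ s → f (suc s))             ≈⟨ ∑-drop k d (λ s → f (suc s)) (λ s s<k → e (suc s) (s≤s s<k)) ⟩
    ∑ d (λ t → f (suc k ℕ.+ t))               ∎

  ∑-swap : ∀ n (f : ℕ → ℕ → Carrier) → (∀ k s → s < k → f k s ≈ 0#) → ∑ n (λ k → ∑ n (f k)) ≈ ∑ n (λ s → ∑ s (λ k → f k s))
  ∑-swap zero f e = refl
  ∑-swap (suc n) f e = begin
    ∑ n (λ k → ∑ n (f k) + f k (suc n)) + (∑ n (f (suc n)) + f (suc n) (suc n))
      ≈⟨ +-cong (∑-+ n (λ k → ∑ n (f k)) (λ k → f k (suc n)))
                (trans (+-congʳ (∑-zero n (λ s s≤n → e (suc n) s (s≤s s≤n)))) (+-identityˡ _)) ⟩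
    (∑ n (λ k → ∑ n (f k)) + ∑ n (λ k → f k (suc n))) + f (suc n) (suc n)
      ≈⟨ trans (+-assoc _ _ _) (+-congʳ (∑-swap n f e)) ⟩
    ∑ n (λ s → ∑ s (λ k → f k s)) + ∑ (suc n) (λ k → f k (suc n)) ∎

  ∑-∣ : ∀ n x f → (∀ k → k ≤ n → x ∣ f k) → x ∣ ∑ n f
  ∑-∣ zero x f d = d 0 z≤n
  ∑-∣ (suc n) x f d with ∑-∣ n x f (λ k k≤n → d k (ℕ.m≤n⇒m≤1+n k≤n)) | d (suc n) ℕ.≤-refl
  ... | y , e | z , e′ = y + z , trans (distribʳ x y z) (+-cong e e′)

  telescope : ∀ n (t G : ℕ → Carrier) → (∀ k → k ≤ n → t k + G (suc k) ≈ G k) → ∑ n t + G (suc n) ≈ G 0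
  telescope zero t G e = e 0 z≤n
  telescope (suc n) t G e = trans (trans (+-assoc _ _ _) (+-congˡ (e (suc n) ℕ.≤-refl)))
    (telescope n t G (λ k k≤n → e k (ℕ.m≤n⇒m≤1+n k≤n)))

  -- The q-Chu-Vandermonde formula

  -- Induction on `M`, applying the q-Pascal rule to the factor `bin M (c ∸ j)`. The truncated
  -- exponent is harmless, since that factor is 0 as soon as `c ∸ j` exceeds `M`.
  vandermonde : ∀ M N c → ∑ c (λ j → q ^ (j ℕ.* (M ∸ (c ∸ j))) * (bin M (c ∸ j) * bin N j)) ≈ bin (M ℕ.+ N) c
  vandermonde zero N zero = trans (*-identityˡ _) (*-identityˡ _)
  vandermonde zero N (suc c) = begin
    ∑ c t + t (suc c)
      ≈⟨ +-cong (∑-zero c vanish) last ⟩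
    0# + bin N (suc c) ≈⟨ +-identityˡ _ ⟩
    bin N (suc c) ∎
    where
    t : ℕ → Carrier
    t j = q ^ (j ℕ.* (0 ∸ (suc c ∸ j))) * (bin 0 (suc c ∸ j) * bin N j)
    vanish : ∀ j → j ≤ c → t j ≈ 0#
    vanish j j≤c rewrite ℕ.+-∸-assoc 1 j≤c = trans (*-congˡ (zeroˡ _)) (zeroʳ _)
    last : t (suc c) ≈ bin N (suc c)
    last rewrite ℕ.n∸n≡0 c | ℕ.*-zeroʳ c = trans (*-identityˡ _) (*-identityˡ _)
  vandermonde (suc M) N zero = trans (*-identityˡ _) (*-identityˡ _)
  vandermonde (suc M) N (suc c) = begin
    ∑ c t + t (suc c)
      ≈⟨ +-cong (trans (∑-cong c split) (∑-+ c t₁ (λ j → q ^ suc c * t₂ j))) last ⟩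
    (∑ c t₁ + ∑ c (λ j → q ^ suc c * t₂ j)) + q ^ suc c * t₂ (suc c)
      ≈⟨ +-assoc _ _ _ ⟩
    ∑ c t₁ + ∑ (suc c) (λ j → q ^ suc c * t₂ j)
      ≈⟨ +-cong (vandermonde M N c) (trans (∑-*ˡ (suc c) (q ^ suc c) t₂) (*-congˡ (vandermonde M N (suc c)))) ⟩
    bin (suc M ℕ.+ N) (suc c) ∎
    where
    t t₁ t₂ : ℕ → Carrier
    t j = q ^ (j ℕ.* (suc M ∸ (suc c ∸ j))) * (bin (suc M) (suc c ∸ j) * bin N j)
    t₁ j = q ^ (j ℕ.* (M ∸ (c ∸ j))) * (bin M (c ∸ j) * bin N j)
    t₂ j = q ^ (j ℕ.* (M ∸ (suc c ∸ j))) * (bin M (suc c ∸ j) * bin N j)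
    -- The Pascal factor q^(i+1) joins q^(j(M-i)), and i + j = c turns the product into q^(c+1)
    -- q^(j(M-i-1)), so q^(c+1) leaves the sum. If M ≤ i, both sides contain a vanishing binomial.
    shift : ∀ i j → i ℕ.+ j ≡ c → q ^ (j ℕ.* (M ∸ i)) * (q ^ suc i * bin M (suc i))
              ≈ q ^ suc c * (q ^ (j ℕ.* (M ∸ suc i)) * bin M (suc i))
    shift i j ≡.refl with ℕ.≤-<-connex (suc i) M
    ... | inj₂ M<i = trans (*-congˡ (trans (*-congˡ (bin-zero M<i)) (zeroʳ _)))
      (trans (zeroʳ _) (sym (trans (*-congˡ (trans (*-congˡ (bin-zero M<i)) (zeroʳ _))) (zeroʳ _))))
    ... | inj₁ i<M = begin
      q ^ (j ℕ.* (M ∸ i)) * (q ^ suc i * b)                 ≈⟨ *-assoc _ _ _ ⟨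
      q ^ (j ℕ.* (M ∸ i)) * q ^ suc i * b                   ≈⟨ *-congʳ (^-homo-* q (j ℕ.* (M ∸ i)) (suc i)) ⟨
      q ^ (j ℕ.* (M ∸ i) ℕ.+ suc i) * b                     ≈⟨ *-congʳ (^-congʳ q exponent) ⟩
      q ^ (suc (i ℕ.+ j) ℕ.+ j ℕ.* (M ∸ suc i)) * b         ≈⟨ *-congʳ (^-homo-* q (suc (i ℕ.+ j)) (j ℕ.* (M ∸ suc i))) ⟩
      q ^ suc (i ℕ.+ j) * q ^ (j ℕ.* (M ∸ suc i)) * b       ≈⟨ *-assoc _ _ _ ⟩
      q ^ suc (i ℕ.+ j) * (q ^ (j ℕ.* (M ∸ suc i)) * b)     ∎
      where
      b = bin M (suc i)
      lem : ∀ i j e → j ℕ.* suc e ℕ.+ suc i ≡ suc (i ℕ.+ j) ℕ.+ j ℕ.* e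
      lem = ℕSolver.solve-∀
      exponent : j ℕ.* (M ∸ i) ℕ.+ suc i ≡ suc (i ℕ.+ j) ℕ.+ j ℕ.* (M ∸ suc i)
      exponent = ≡.trans (≡.cong (λ x → j ℕ.* x ℕ.+ suc i) (ℕ.+-∸-assoc 1 i<M)) (lem i j (M ∸ suc i))
    split : ∀ j → j ≤ c → t j ≈ t₁ j + q ^ suc c * t₂ j
    split j j≤c rewrite ℕ.+-∸-assoc 1 j≤c = begin
      Q * ((bin M i + q ^ suc i * bin M (suc i)) * bin N j)
        ≈⟨ solve 5 (λ Q b₁ x b₂ n → Q :* ((b₁ :+ x :* b₂) :* n) := Q :* (b₁ :* n) :+ (Q :* (x :* b₂)) :* n) refl
             Q (bin M i) (q ^ suc i) (bin M (suc i)) (bin N j) ⟩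
      Q * (bin M i * bin N j) + (Q * (q ^ suc i * bin M (suc i))) * bin N j
        ≈⟨ +-congˡ (*-congʳ (shift i j (ℕ.m∸n+n≡m j≤c))) ⟩
      Q * (bin M i * bin N j) + (q ^ suc c * (q ^ (j ℕ.* (M ∸ suc i)) * bin M (suc i))) * bin N j
        ≈⟨ +-congˡ (trans (*-assoc _ _ _) (*-congˡ (*-assoc _ _ _))) ⟩
      Q * (bin M i * bin N j) + q ^ suc c * (q ^ (j ℕ.* (M ∸ suc i)) * (bin M (suc i) * bin N j)) ∎
      where
      i = c ∸ j
      Q = q ^ (j ℕ.* (M ∸ i))
    last : t (suc c) ≈ q ^ suc c * t₂ (suc c)
    last rewrite ℕ.n∸n≡0 c = begin
      q ^ (suc c ℕ.* suc M) * (1# * bin N (suc c))         ≈⟨ *-congʳ (trans (^-congʳ q (ℕ.*-suc (suc c) M)) (^-homo-* q (suc c) (suc c ℕ.* M))) ⟩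
      q ^ suc c * q ^ (suc c ℕ.* M) * (1# * bin N (suc c)) ≈⟨ *-assoc _ _ _ ⟩
      q ^ suc c * (q ^ (suc c ℕ.* M) * (1# * bin N (suc c))) ∎

  -- Binomials with a shifted lower index

  -- This is (N choose a-k) by simultaneous descent in `a` and `k`: a negative lower index has to
  -- give 0, whereas truncated subtraction would give `bin N 0`, which is 1.
  low : ℕ → ℕ → ℕ → Carrier
  low N a zero = bin N a
  low N zero (suc k) = 0#
  low N (suc a) (suc k) = low N a k

  low-+ : ∀ N k d → low N (k ℕ.+ d) k ≡ bin N d
  low-+ N zero d = ≡.refl
  low-+ N (suc k) d = low-+ N k d

  low-< : ∀ N {a k} → a < k → low N a k ≡ 0#
  low-< N {zero} (s≤s _) = ≡.refl
  low-< N {suc a} (s≤s a<k) = low-< N a<k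

  -- (a+b+1 choose a-k), which is 0 for a < k
  B : ℕ → ℕ → ℕ → Carrier
  B a b k = low (a ℕ.+ b ℕ.+ 1) a k

  bin-cong : ∀ {m n} k → m ≡ n → bin m k ≈ bin n k
  bin-cong k e = reflexive (≡.cong (λ x → bin x k) e)

  B-choose : ∀ k d b x → k ℕ.+ b ℕ.+ 1 ≡ x → B (k ℕ.+ d) b k ≈ choose d x
  B-choose k d b x ≡.refl = trans (reflexive (low-+ (k ℕ.+ d ℕ.+ b ℕ.+ 1) k d)) (bin-cong d (lem k d b))
    where
    lem : ∀ k d b → k ℕ.+ d ℕ.+ b ℕ.+ 1 ≡ d ℕ.+ (k ℕ.+ b ℕ.+ 1)
    lem = ℕSolver.solve-∀

  B-zero : ∀ b {a k} → a < k → B a b k ≈ 0#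
  B-zero b {a} a<k = reflexive (low-< (a ℕ.+ b ℕ.+ 1) a<k)

  -- By `D-fac` this is [a+b+1]! / ([a]! [b]!), a form symmetric in `a` and `b`.
  D : ℕ → ℕ → Carrier
  D a b = [ a ℕ.+ b ℕ.+ 1 ] * bin (a ℕ.+ b) a

  D-fac : ∀ a b → D a b * (fac a * fac b) ≈ fac (suc (a ℕ.+ b))
  D-fac a b = trans (*-assoc _ _ _) (*-cong ([]-cong (ℕ.+-comm (a ℕ.+ b) 1)) (choose-fac a b))

  -- The two convolutions behind the merging of vertices

  -- The one property of κ that a merge uses. With s = k + t, the two binomials are what still
  -- depends on s after `B-exchange` and `B-refine`; μ is the power of q that the merge absorbs.
  Convolution : ℕ → ℕ → (κ μ : ℕ → Carrier) → Set ℓ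
  Convolution a b κ μ = ∀ k d g → k ℕ.+ d ≡ a → k ℕ.+ g ≡ b →
    ∑ d (λ t → κ (k ℕ.+ t) * (bin (a ℕ.+ k ℕ.+ 1) (d ∸ t) * bin g t)) ≈ μ k * bin (a ℕ.+ b ℕ.+ 1) d

  κ₀ : ℕ → ℕ → ℕ → Carrier
  κ₀ a b s = q ^ ((a ∸ s) ℕ.* (b ∸ s))

  κ₁ : ℕ → Carrier
  κ₁ s = q ^ (s ℕ.* s ℕ.+ s)

  -- The exponent splits as (k+t)² + (k+t) = (k² + k) + t(2k+1+t), and 2k+1+t is M - (d-t) for M =
  -- a+k+1, exactly the exponent in `vandermonde`.
  convolution₁ : ∀ a b → Convolution a b κ₁ κ₁
  convolution₁ a b k d g ≡.refl ≡.refl = begin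
    ∑ d (λ t → q ^ ((k ℕ.+ t) ℕ.* (k ℕ.+ t) ℕ.+ (k ℕ.+ t)) * (bin M (d ∸ t) * bin g t))
      ≈⟨ ∑-cong d (λ t t≤d → trans (*-congʳ (trans (^-congʳ q (exponent t t≤d)) (^-homo-* q (k ℕ.* k ℕ.+ k) _))) (*-assoc _ _ _)) ⟩
    ∑ d (λ t → μ * (q ^ (t ℕ.* (M ∸ (d ∸ t))) * (bin M (d ∸ t) * bin g t)))
      ≈⟨ ∑-*ˡ d μ _ ⟩
    μ * ∑ d (λ t → q ^ (t ℕ.* (M ∸ (d ∸ t))) * (bin M (d ∸ t) * bin g t))
      ≈⟨ *-congˡ (vandermonde M g d) ⟩
    μ * bin (M ℕ.+ g) d
      ≈⟨ *-congˡ (bin-cong d (lem k d g)) ⟩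
    μ * bin (k ℕ.+ d ℕ.+ (k ℕ.+ g) ℕ.+ 1) d ∎
    where
    M = k ℕ.+ d ℕ.+ k ℕ.+ 1
    μ = q ^ (k ℕ.* k ℕ.+ k)
    lem : ∀ k d g → k ℕ.+ d ℕ.+ k ℕ.+ 1 ℕ.+ g ≡ k ℕ.+ d ℕ.+ (k ℕ.+ g) ℕ.+ 1
    lem = ℕSolver.solve-∀
    lem₁ : ∀ k t e → k ℕ.+ (e ℕ.+ t) ℕ.+ k ℕ.+ 1 ≡ (k ℕ.+ k ℕ.+ 1 ℕ.+ t) ℕ.+ e
    lem₁ = ℕSolver.solve-∀
    lem₂ : ∀ k t → (k ℕ.+ t) ℕ.* (k ℕ.+ t) ℕ.+ (k ℕ.+ t) ≡ (k ℕ.* k ℕ.+ k) ℕ.+ t ℕ.* (k ℕ.+ k ℕ.+ 1 ℕ.+ t)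
    lem₂ = ℕSolver.solve-∀
    M∸ : ∀ t → t ≤ d → M ∸ (d ∸ t) ≡ k ℕ.+ k ℕ.+ 1 ℕ.+ t
    M∸ t t≤d = ≡.trans
      (≡.cong (_∸ (d ∸ t)) (≡.trans (≡.cong (λ x → k ℕ.+ x ℕ.+ k ℕ.+ 1) (≡.sym (ℕ.m∸n+n≡m t≤d))) (lem₁ k t (d ∸ t))))
      (ℕ.m+n∸n≡m _ (d ∸ t))
    exponent : ∀ t → t ≤ d → (k ℕ.+ t) ℕ.* (k ℕ.+ t) ℕ.+ (k ℕ.+ t) ≡ (k ℕ.* k ℕ.+ k) ℕ.+ t ℕ.* (M ∸ (d ∸ t))
    exponent t t≤d = ≡.trans (lem₂ k t) (≡.cong (λ x → (k ℕ.* k ℕ.+ k) ℕ.+ t ℕ.* x) (≡.sym (M∸ t t≤d)))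

  -- The same formula with its two binomials interchanged and the sum reversed: at j = d - t the
  -- exponent j(g-(d-j)) is (d-t)(g-t), that is (a-s)(b-s). No power depending on k alone splits
  -- off, so μ = 1.
  convolution₀ : ∀ a b → Convolution a b (κ₀ a b) (λ _ → 1#)
  convolution₀ a b k d g ≡.refl ≡.refl = begin
    ∑ d (λ t → q ^ ((k ℕ.+ d ∸ (k ℕ.+ t)) ℕ.* (k ℕ.+ g ∸ (k ℕ.+ t))) * (bin M (d ∸ t) * bin g t))
      ≈⟨ ∑-cong d reflect ⟩
    ∑ d (λ t → f (d ∸ t))              ≈⟨ ∑-rev d f ⟩
    ∑ d f                              ≈⟨ vandermonde g M d ⟩
    bin (g ℕ.+ M) d                    ≈⟨ trans (bin-cong d (lem k d g)) (sym (*-identityˡ _)) ⟩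
    1# * bin (k ℕ.+ d ℕ.+ (k ℕ.+ g) ℕ.+ 1) d ∎
    where
    M = k ℕ.+ d ℕ.+ k ℕ.+ 1
    f : ℕ → Carrier
    f j = q ^ (j ℕ.* (g ∸ (d ∸ j))) * (bin g (d ∸ j) * bin M j)
    lem : ∀ k d g → g ℕ.+ (k ℕ.+ d ℕ.+ k ℕ.+ 1) ≡ k ℕ.+ d ℕ.+ (k ℕ.+ g) ℕ.+ 1
    lem = ℕSolver.solve-∀
    reflect : ∀ t → t ≤ d → q ^ ((k ℕ.+ d ∸ (k ℕ.+ t)) ℕ.* (k ℕ.+ g ∸ (k ℕ.+ t))) * (bin M (d ∸ t) * bin g t) ≈ f (d ∸ t)
    reflect t t≤d rewrite ℕ.m∸[m∸n]≡n t≤d | ℕ.[m+n]∸[m+o]≡n∸o k d t | ℕ.[m+n]∸[m+o]≡n∸o k g t = *-congˡ (*-comm _ _)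

  -- Cyclic products and their weighted sums

  path : ℕ → List ℕ → ℕ → Carrier
  path a [] k = 1#
  path a (b ∷ l) k = B a b k * path b l k

  final : ℕ → List ℕ → ℕ
  final a [] = a
  final a (b ∷ l) = final b l

  -- A cycle is stored as its first vertex and the list of the others. Merging the first two
  -- vertices then changes only the front, and as long as three or more vertices are present `final`
  -- stays put.
  cyc : ℕ → List ℕ → ℕ → Carrier
  cyc a l k = path a l k * B (final a l) a k

  cyc-zero : ∀ a l {k} → a < k → cyc a l k ≈ 0#
  cyc-zero a [] a<k = trans (*-congˡ (B-zero a a<k)) (zeroʳ _)
  cyc-zero a (b ∷ l) a<k = trans (*-congʳ (trans (*-congʳ (B-zero b a<k)) (zeroˡ _))) (zeroˡ _)

  cycSum : (ℕ → Carrier) → ℕ → List ℕ → Carrier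
  cycSum w a l = ∑ a (λ k → w k * cyc a l k)

  cycSum-cong : ∀ {w w′} a l → (∀ k → w k ≈ w′ k) → cycSum w a l ≈ cycSum w′ a l
  cycSum-cong a l e = ∑-cong a (λ k _ → *-congʳ (e k))

  weight : (ℕ → Carrier) → ℕ → ℕ → Carrier
  weight w j k = q ^ (j ℕ.* (k ℕ.* k ℕ.+ k)) * w k

  -- Binomial identities by cancelling q-factorials

  module Cancellative (cancel : ∀ n x → [ suc n ] * x ≈ 0# → x ≈ 0#) where

    []-cancel : ∀ n {x y} → [ suc n ] * x ≈ [ suc n ] * y → x ≈ y
    []-cancel n {x} {y} e = x∙y⁻¹≈ε⇒x≈y x y (cancel n (x - y)
      (trans (x[y-z]≈xy-xz _ x y) (trans (+-congʳ e) (-‿inverseʳ _))))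

    fac-cancel : ∀ n {x y} → x * fac n ≈ y * fac n → x ≈ y
    fac-cancel zero e = trans (sym (*-identityʳ _)) (trans e (*-identityʳ _))
    fac-cancel (suc n) {x} {y} e = fac-cancel n ([]-cancel n (trans (lem x) (trans e (sym (lem y)))))
      where
      lem : ∀ x → [ suc n ] * (x * fac n) ≈ x * ([ suc n ] * fac n)
      lem x = solve 3 (λ a b c → a :* (b :* c) := b :* (a :* c)) refl [ suc n ] x (fac n)

    fac-cancel₃ : ∀ a b c {x y} → x * (fac a * (fac b * fac c)) ≈ y * (fac a * (fac b * fac c)) → x ≈ y
    fac-cancel₃ a b c {x} {y} e = fac-cancel a (fac-cancel b (fac-cancel c (trans (lem x) (trans e (sym (lem y))))))
      where
      lem : ∀ x → x * fac a * fac b * fac c ≈ x * (fac a * (fac b * fac c))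
      lem x = solve 4 (λ x a b c → x :* a :* b :* c := x :* (a :* (b :* c))) refl x (fac a) (fac b) (fac c)

    -- The product of the two binomials is a q-trinomial coefficient, hence symmetric in its three
    -- parts; `choose-exchange` and `choose-refine` are two instances of that symmetry.
    trinomial-fac : ∀ u v x → choose u (v ℕ.+ x) * choose v x * (fac u * (fac v * fac x)) ≈ fac (u ℕ.+ (v ℕ.+ x))
    trinomial-fac u v x = begin
      choose u (v ℕ.+ x) * choose v x * (fac u * (fac v * fac x))
        ≈⟨ solve 5 (λ p q a b c → p :* q :* (a :* (b :* c)) := p :* (a :* (q :* (b :* c)))) refl _ _ _ _ _ ⟩
      choose u (v ℕ.+ x) * (fac u * (choose v x * (fac v * fac x)))
        ≈⟨ *-congˡ (*-congˡ (choose-fac v x)) ⟩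
      choose u (v ℕ.+ x) * (fac u * fac (v ℕ.+ x))
        ≈⟨ choose-fac u (v ℕ.+ x) ⟩
      fac (u ℕ.+ (v ℕ.+ x)) ∎

    choose-exchange : ∀ u v x → choose u (v ℕ.+ x) * choose v x ≈ choose v (u ℕ.+ x) * choose u x
    choose-exchange u v x = fac-cancel₃ u v x (begin
      choose u (v ℕ.+ x) * choose v x * (fac u * (fac v * fac x))  ≈⟨ trinomial-fac u v x ⟩
      fac (u ℕ.+ (v ℕ.+ x))                                        ≡⟨ ≡.cong fac (lem u v x) ⟩
      fac (v ℕ.+ (u ℕ.+ x))                                        ≈⟨ trinomial-fac v u x ⟨
      choose v (u ℕ.+ x) * choose u x * (fac v * (fac u * fac x))
        ≈⟨ *-congˡ (solve 3 (λ a b c → a :* (b :* c) := b :* (a :* c)) refl _ _ _) ⟩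
      choose v (u ℕ.+ x) * choose u x * (fac u * (fac v * fac x)) ∎)
      where
      lem : ∀ u v x → u ℕ.+ (v ℕ.+ x) ≡ v ℕ.+ (u ℕ.+ x)
      lem = ℕSolver.solve-∀

    choose-refine : ∀ w t x → choose w (t ℕ.+ x) * choose t x ≈ choose (t ℕ.+ w) x * choose t w
    choose-refine w t x = fac-cancel₃ w t x (begin
      choose w (t ℕ.+ x) * choose t x * (fac w * (fac t * fac x))  ≈⟨ trinomial-fac w t x ⟩
      fac (w ℕ.+ (t ℕ.+ x))                                        ≡⟨ ≡.cong fac (lem w t x) ⟩
      fac (t ℕ.+ w ℕ.+ x)                                          ≈⟨ choose-fac (t ℕ.+ w) x ⟨
      choose (t ℕ.+ w) x * (fac (t ℕ.+ w) * fac x)                 ≈⟨ *-congˡ (*-congʳ (choose-fac t w)) ⟨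
      choose (t ℕ.+ w) x * (choose t w * (fac t * fac w) * fac x)
        ≈⟨ solve 5 (λ p q a b c → p :* (q :* (b :* a) :* c) := p :* q :* (a :* (b :* c))) refl _ _ _ _ _ ⟩
      choose (t ℕ.+ w) x * choose t w * (fac w * (fac t * fac x)) ∎)
      where
      lem : ∀ w t x → w ℕ.+ (t ℕ.+ x) ≡ t ℕ.+ w ℕ.+ x
      lem = ℕSolver.solve-∀

    -- Here s = k + t is the merged vertex and k + t + u the old one. For z = k + v both sides are
    -- the trinomial coefficient with parts u, v and 2k+t+1. Its purpose is to leave s in a single
    -- binomial, with the factor between z and the old vertex restored.
    B-exchange : ∀ k t u z → B (k ℕ.+ t ℕ.+ u) z (k ℕ.+ t) * B z (k ℕ.+ t) k
      ≈ B z (k ℕ.+ t ℕ.+ u) k * bin (k ℕ.+ t ℕ.+ u ℕ.+ k ℕ.+ 1) u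
    B-exchange k t u z with ℕ.≤-<-connex k z
    ... | inj₂ z<k = trans (*-congˡ (B-zero (k ℕ.+ t) z<k)) (trans (zeroʳ _)
      (sym (trans (*-congʳ (B-zero (k ℕ.+ t ℕ.+ u) z<k)) (zeroˡ _))))
    ... | inj₁ k≤z with ℕ.m≤n⇒∃[o]m+o≡n k≤z
    ... | v , ≡.refl = begin
      B (k ℕ.+ t ℕ.+ u) (k ℕ.+ v) (k ℕ.+ t) * B (k ℕ.+ v) (k ℕ.+ t) k
        ≈⟨ *-cong (B-choose (k ℕ.+ t) u (k ℕ.+ v) (v ℕ.+ x) (lem₁ k t v)) (B-choose k v (k ℕ.+ t) x ≡.refl) ⟩
      choose u (v ℕ.+ x) * choose v x
        ≈⟨ choose-exchange u v x ⟩
      choose v (u ℕ.+ x) * choose u x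
        ≈⟨ *-cong (B-choose k v (k ℕ.+ t ℕ.+ u) (u ℕ.+ x) (lem₂ k t u)) (bin-cong u (lem₃ k t u)) ⟨
      B (k ℕ.+ v) (k ℕ.+ t ℕ.+ u) k * bin (k ℕ.+ t ℕ.+ u ℕ.+ k ℕ.+ 1) u ∎
      where
      x = k ℕ.+ (k ℕ.+ t) ℕ.+ 1
      lem₁ : ∀ k t v → k ℕ.+ t ℕ.+ (k ℕ.+ v) ℕ.+ 1 ≡ v ℕ.+ (k ℕ.+ (k ℕ.+ t) ℕ.+ 1)
      lem₁ = ℕSolver.solve-∀
      lem₂ : ∀ k t u → k ℕ.+ (k ℕ.+ t ℕ.+ u) ℕ.+ 1 ≡ u ℕ.+ (k ℕ.+ (k ℕ.+ t) ℕ.+ 1)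
      lem₂ = ℕSolver.solve-∀
      lem₃ : ∀ k t u → k ℕ.+ t ℕ.+ u ℕ.+ k ℕ.+ 1 ≡ u ℕ.+ (k ℕ.+ (k ℕ.+ t) ℕ.+ 1)
      lem₃ = ℕSolver.solve-∀

    -- The counterpart of `B-exchange` at the other neighbour c: for b = k + t + w both sides are
    -- the trinomial coefficient with parts w, t and k+c+1. Outside k + t ≤ b both sides vanish.
    B-refine : ∀ k t b c → B b c (k ℕ.+ t) * B (k ℕ.+ t) c k ≈ B b c k * bin (b ∸ k) t
    B-refine k t b c with ℕ.≤-<-connex k b
    ... | inj₂ b<k = trans (*-congʳ (B-zero c (ℕ.<-≤-trans b<k (ℕ.m≤m+n k t)))) (trans (zeroˡ _)
      (sym (trans (*-congʳ (B-zero c b<k)) (zeroˡ _))))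
    ... | inj₁ k≤b with ℕ.m≤n⇒∃[o]m+o≡n k≤b
    ... | e , ≡.refl with ℕ.≤-<-connex t e
    ... | inj₂ e<t = trans (*-congʳ (B-zero c (ℕ.+-monoʳ-< k e<t))) (trans (zeroˡ _)
      (sym (trans (*-congˡ (trans (bin-cong t (ℕ.m+n∸m≡n k e)) (bin-zero e<t))) (zeroʳ _))))
    ... | inj₁ t≤e with ℕ.m≤n⇒∃[o]m+o≡n t≤e
    ... | w , ≡.refl = begin
      B (k ℕ.+ (t ℕ.+ w)) c (k ℕ.+ t) * B (k ℕ.+ t) c k
        ≡⟨ ≡.cong (λ y → B y c (k ℕ.+ t) * B (k ℕ.+ t) c k) (≡.sym (ℕ.+-assoc k t w)) ⟩
      B (k ℕ.+ t ℕ.+ w) c (k ℕ.+ t) * B (k ℕ.+ t) c k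
        ≈⟨ *-cong (B-choose (k ℕ.+ t) w c (t ℕ.+ x) (lem k t c)) (B-choose k t c x ≡.refl) ⟩
      choose w (t ℕ.+ x) * choose t x
        ≈⟨ choose-refine w t x ⟩
      choose (t ℕ.+ w) x * choose t w
        ≈⟨ *-cong (B-choose k (t ℕ.+ w) c x ≡.refl) (bin-cong t (ℕ.m+n∸m≡n k (t ℕ.+ w))) ⟨
      B (k ℕ.+ (t ℕ.+ w)) c k * bin (k ℕ.+ (t ℕ.+ w) ∸ k) t ∎
      where
      x = k ℕ.+ c ℕ.+ 1
      lem : ∀ k t c → k ℕ.+ t ℕ.+ c ℕ.+ 1 ≡ t ℕ.+ (k ℕ.+ c ℕ.+ 1)
      lem = ℕSolver.solve-∀

    -- Merging two vertices of a cycle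

    -- The common end of both merges. The sum starts at 0 although its terms start at s = k, and
    -- `Convolution` speaks only of k ≤ b; for b < k the factor `Y` vanishes and both sides are 0.
    convolve : ∀ {a b} κ μ → Convolution a b κ μ → ∀ k d → k ℕ.+ d ≡ a → (F : ℕ → Carrier) (Y : Carrier) →
      (∀ s → s < k → F s ≈ 0#) →
      (∀ t → t ≤ d → F (k ℕ.+ t) ≈ κ (k ℕ.+ t) * (bin (a ℕ.+ k ℕ.+ 1) (d ∸ t) * bin (b ∸ k) t) * Y) →
      (b < k → Y ≈ 0#) → ∑ a F ≈ μ k * (B a b k * Y)
    convolve {a} {b} κ μ H k d ≡.refl F Y below F≈ Y≈0 with ℕ.≤-<-connex k b
    ... | inj₂ b<k = begin
      ∑ (k ℕ.+ d) F               ≈⟨ ∑-drop k d F below ⟩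
      ∑ d (λ t → F (k ℕ.+ t))     ≈⟨ ∑-zero d (λ t t≤d → trans (F≈ t t≤d) (trans (*-congˡ (Y≈0 b<k)) (zeroʳ _))) ⟩
      0#                          ≈⟨ trans (*-congˡ (trans (*-congˡ (Y≈0 b<k)) (zeroʳ _))) (zeroʳ _) ⟨
      μ k * (B (k ℕ.+ d) b k * Y) ∎
    ... | inj₁ k≤b with ℕ.m≤n⇒∃[o]m+o≡n k≤b
    ... | g , ≡.refl = begin
      ∑ (k ℕ.+ d) F               ≈⟨ ∑-drop k d F below ⟩
      ∑ d (λ t → F (k ℕ.+ t))     ≈⟨ ∑-cong d (λ t t≤d → trans (F≈ t t≤d) (*-congʳ (*-congˡ (*-congˡ (bin-cong t (ℕ.m+n∸m≡n k g)))))) ⟩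
      ∑ d (λ t → κ (k ℕ.+ t) * (bin (k ℕ.+ d ℕ.+ k ℕ.+ 1) (d ∸ t) * bin g t) * Y)
        ≈⟨ ∑-*ʳ d Y _ ⟩
      ∑ d (λ t → κ (k ℕ.+ t) * (bin (k ℕ.+ d ℕ.+ k ℕ.+ 1) (d ∸ t) * bin g t)) * Y
        ≈⟨ *-congʳ (H k d g ≡.refl ≡.refl) ⟩
      μ k * bin (k ℕ.+ d ℕ.+ (k ℕ.+ g) ℕ.+ 1) d * Y
        ≈⟨ trans (*-assoc _ _ _) (*-congˡ (*-congʳ (reflexive (≡.sym (low-+ _ k d))))) ⟩
      μ k * (B (k ℕ.+ d) (k ℕ.+ g) k * Y) ∎

    bailey₃ : ∀ {a b} κ μ → Convolution a b κ μ → ∀ c z k → k ≤ a →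
      ∑ a (λ s → κ s * (B a z s * B b c s) * (B s c k * B z s k)) ≈ μ k * (B a b k * (B b c k * B z a k))
    bailey₃ {a} {b} κ μ H c z k k≤a with ℕ.m≤n⇒∃[o]m+o≡n k≤a
    ... | d , ≡.refl = convolve κ μ H k d ≡.refl _ (B b c k * B z (k ℕ.+ d) k)
      (λ s s<k → trans (*-congˡ (trans (*-congʳ (B-zero c s<k)) (zeroˡ _))) (zeroʳ _))
      factor
      (λ b<k → trans (*-congʳ (B-zero c b<k)) (zeroˡ _))
      where
      factor : ∀ t → t ≤ d → κ (k ℕ.+ t) * (B (k ℕ.+ d) z (k ℕ.+ t) * B b c (k ℕ.+ t)) * (B (k ℕ.+ t) c k * B z (k ℕ.+ t) k)
        ≈ κ (k ℕ.+ t) * (bin (k ℕ.+ d ℕ.+ k ℕ.+ 1) (d ∸ t) * bin (b ∸ k) t) * (B b c k * B z (k ℕ.+ d) k)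
      factor t t≤d with ℕ.m≤n⇒∃[o]m+o≡n t≤d
      ... | u , ≡.refl rewrite ℕ.m+n∸m≡n t u | ≡.sym (ℕ.+-assoc k t u) = begin
        κ (k ℕ.+ t) * (B a′ z (k ℕ.+ t) * B b c (k ℕ.+ t)) * (B (k ℕ.+ t) c k * B z (k ℕ.+ t) k)
          ≈⟨ solve 5 (λ κ x y z w → κ :* (x :* y) :* (z :* w) := κ :* ((x :* w) :* (y :* z))) refl _ _ _ _ _ ⟩
        κ (k ℕ.+ t) * ((B a′ z (k ℕ.+ t) * B z (k ℕ.+ t) k) * (B b c (k ℕ.+ t) * B (k ℕ.+ t) c k))
          ≈⟨ *-congˡ (*-cong (B-exchange k t u z) (B-refine k t b c)) ⟩
        κ (k ℕ.+ t) * ((B z a′ k * bin (a′ ℕ.+ k ℕ.+ 1) u) * (B b c k * bin (b ∸ k) t))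
          ≈⟨ solve 5 (λ κ x y z w → κ :* ((x :* y) :* (z :* w)) := κ :* (y :* w) :* (z :* x)) refl _ _ _ _ _ ⟩
        κ (k ℕ.+ t) * (bin (a′ ℕ.+ k ℕ.+ 1) u * bin (b ∸ k) t) * (B b c k * B z a′ k) ∎
        where a′ = k ℕ.+ t ℕ.+ u

    -- In a cycle of two vertices the merged vertex s is its own neighbour, so c of `bailey₃` would
    -- be the summation variable. The refinement is therefore applied first, with c = s, and yields
    -- the factor B(b,s;k) that the exchange with z = b consumes.
    bailey₂ : ∀ {a b} κ μ → Convolution a b κ μ → ∀ k → k ≤ a →
      ∑ a (λ s → κ s * (B a b s * B b s s) * B s s k) ≈ μ k * (B a b k * B b a k)
    bailey₂ {a} {b} κ μ H k k≤a with ℕ.m≤n⇒∃[o]m+o≡n k≤a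
    ... | d , ≡.refl = convolve κ μ H k d ≡.refl _ (B b (k ℕ.+ d) k)
      (λ s s<k → trans (*-congˡ (B-zero s s<k)) (zeroʳ _))
      factor
      (B-zero (k ℕ.+ d))
      where
      factor : ∀ t → t ≤ d → κ (k ℕ.+ t) * (B (k ℕ.+ d) b (k ℕ.+ t) * B b (k ℕ.+ t) (k ℕ.+ t)) * B (k ℕ.+ t) (k ℕ.+ t) k
        ≈ κ (k ℕ.+ t) * (bin (k ℕ.+ d ℕ.+ k ℕ.+ 1) (d ∸ t) * bin (b ∸ k) t) * B b (k ℕ.+ d) k
      factor t t≤d with ℕ.m≤n⇒∃[o]m+o≡n t≤d
      ... | u , ≡.refl rewrite ℕ.m+n∸m≡n t u | ≡.sym (ℕ.+-assoc k t u) = begin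
        κ (k ℕ.+ t) * (B a′ b (k ℕ.+ t) * B b (k ℕ.+ t) (k ℕ.+ t)) * B (k ℕ.+ t) (k ℕ.+ t) k
          ≈⟨ solve 4 (λ κ x y z → κ :* (x :* y) :* z := κ :* (x :* (y :* z))) refl _ _ _ _ ⟩
        κ (k ℕ.+ t) * (B a′ b (k ℕ.+ t) * (B b (k ℕ.+ t) (k ℕ.+ t) * B (k ℕ.+ t) (k ℕ.+ t) k))
          ≈⟨ *-congˡ (*-congˡ (B-refine k t b (k ℕ.+ t))) ⟩
        κ (k ℕ.+ t) * (B a′ b (k ℕ.+ t) * (B b (k ℕ.+ t) k * bin (b ∸ k) t))
          ≈⟨ *-congˡ (trans (sym (*-assoc _ _ _)) (*-congʳ (B-exchange k t u b))) ⟩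
        κ (k ℕ.+ t) * ((B b a′ k * bin (a′ ℕ.+ k ℕ.+ 1) u) * bin (b ∸ k) t)
          ≈⟨ solve 4 (λ κ x y w → κ :* ((x :* y) :* w) := κ :* (y :* w) :* x) refl _ _ _ _ ⟩
        κ (k ℕ.+ t) * (bin (a′ ℕ.+ k ℕ.+ 1) u * bin (b ∸ k) t) * B b a′ k ∎
        where a′ = k ℕ.+ t ℕ.+ u

    -- Terms with s < k vanish, so after the sums are interchanged the inner one ends at k = s and
    -- is itself a cyclic sum, with first vertex s.
    cycSum-step : ∀ (w w′ : ℕ → Carrier) a l l′ (κ : ℕ → Carrier) →
      (∀ k → k ≤ a → ∑ a (λ s → κ s * cyc s l′ k) ≈ w′ k * cyc a l k) →
      cycSum (λ k → w′ k * w k) a l ≈ ∑ a (λ s → κ s * cycSum w s l′)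
    cycSum-step w w′ a l l′ κ H = begin
      ∑ a (λ k → w′ k * w k * cyc a l k)
        ≈⟨ ∑-cong a (λ k k≤a → trans (rearrange k) (trans (*-congˡ (sym (H k k≤a))) (sym (∑-*ˡ a (w k) _)))) ⟩
      ∑ a (λ k → ∑ a (λ s → w k * (κ s * cyc s l′ k)))
        ≈⟨ ∑-swap a (λ k s → w k * (κ s * cyc s l′ k))
             (λ k s s<k → trans (*-congˡ (trans (*-congˡ (cyc-zero s l′ s<k)) (zeroʳ _))) (zeroʳ _)) ⟩
      ∑ a (λ s → ∑ s (λ k → w k * (κ s * cyc s l′ k)))
        ≈⟨ ∑-cong a (λ s _ → trans (∑-cong s (λ k _ → solve 3 (λ x y z → x :* (y :* z) := y :* (x :* z)) refl _ _ _))
             (∑-*ˡ s (κ s) _)) ⟩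
      ∑ a (λ s → κ s * cycSum w s l′) ∎
      where
      rearrange : ∀ k → w′ k * w k * cyc a l k ≈ w k * (w′ k * cyc a l k)
      rearrange k = solve 3 (λ x y z → x :* y :* z := y :* (x :* z)) refl _ _ _

    -- Divisibility along the merges

    -- Multiplied by [s]! [u]! [z]!, both sides become [s+u+z+1]!.
    B-D : ∀ s u z → B (s ℕ.+ u) z s * D s z ≈ D (s ℕ.+ u) z * choose s u
    B-D s u z = fac-cancel₃ s u z (begin
      B (s ℕ.+ u) z s * D s z * (fac s * (fac u * fac z))
        ≈⟨ *-congʳ (*-congʳ (B-choose s u z (suc (s ℕ.+ z)) (ℕ.+-comm _ 1))) ⟩
      choose u (suc (s ℕ.+ z)) * D s z * (fac s * (fac u * fac z))
        ≈⟨ solve 5 (λ x d s u z → x :* d :* (s :* (u :* z)) := x :* (u :* (d :* (s :* z)))) refl _ _ _ _ _ ⟩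
      choose u (suc (s ℕ.+ z)) * (fac u * (D s z * (fac s * fac z)))
        ≈⟨ *-congˡ (*-congˡ (D-fac s z)) ⟩
      choose u (suc (s ℕ.+ z)) * (fac u * fac (suc (s ℕ.+ z)))
        ≈⟨ choose-fac u (suc (s ℕ.+ z)) ⟩
      fac (u ℕ.+ suc (s ℕ.+ z))
        ≡⟨ ≡.cong fac (lem s u z) ⟩
      fac (suc (s ℕ.+ u ℕ.+ z))
        ≈⟨ D-fac (s ℕ.+ u) z ⟨
      D (s ℕ.+ u) z * (fac (s ℕ.+ u) * fac z)
        ≈⟨ *-congˡ (*-congʳ (choose-fac s u)) ⟨
      D (s ℕ.+ u) z * (choose s u * (fac s * fac u) * fac z)
        ≈⟨ solve 5 (λ x d s u z → x :* (d :* (s :* u) :* z) := x :* d :* (s :* (u :* z))) refl _ _ _ _ _ ⟩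
      D (s ℕ.+ u) z * choose s u * (fac s * (fac u * fac z)) ∎)
      where
      lem : ∀ s u z → u ℕ.+ suc (s ℕ.+ z) ≡ suc (s ℕ.+ u ℕ.+ z)
      lem = ℕSolver.solve-∀

    D-comm : ∀ a b → D a b ≈ D b a
    D-comm a b = fac-cancel₃ a b 0 (begin
      D a b * (fac a * (fac b * 1#))   ≈⟨ *-congˡ (*-congˡ (*-identityʳ _)) ⟩
      D a b * (fac a * fac b)          ≈⟨ D-fac a b ⟩
      fac (suc (a ℕ.+ b))              ≡⟨ ≡.cong (λ x → fac (suc x)) (ℕ.+-comm a b) ⟩
      fac (suc (b ℕ.+ a))              ≈⟨ D-fac b a ⟨
      D b a * (fac b * fac a)          ≈⟨ *-congˡ (trans (*-comm _ _) (*-congˡ (sym (*-identityʳ _)))) ⟩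
      D b a * (fac a * (fac b * 1#))   ∎)

    -- α and β stand for the extra powers of [n₁] and [nₘ] in the modulus. The hypotheses say that
    -- the binomial released by `B-D` is enough to turn the value at the merged vertex s into a
    -- multiple of the value at the original vertex.
    module Chain (α β : ℕ → Carrier) (hα : ∀ s u → α (s ℕ.+ u) ∣ choose s u * α s) (hβ : ∀ s u → β (s ℕ.+ u) ∣ choose s u * β s) where

      modulus : ℕ → ℕ → Carrier
      modulus a z = D a z * α a * β z

      first-∣ : ∀ s a z → s ≤ a → modulus a z ∣ B a z s * modulus s z
      first-∣ s a z s≤a with ℕ.m≤n⇒∃[o]m+o≡n s≤a
      ... | u , ≡.refl = ∣ʳ-respʳ-≈ (begin
        D (s ℕ.+ u) z * (choose s u * α s) * β z  ≈⟨ *-congʳ (*-assoc _ _ _) ⟨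
        D (s ℕ.+ u) z * choose s u * α s * β z    ≈⟨ *-congʳ (*-congʳ (B-D s u z)) ⟨
        B (s ℕ.+ u) z s * D s z * α s * β z       ≈⟨ solve 4 (λ a b c d → a :* b :* c :* d := a :* (b :* c :* d)) refl _ _ _ _ ⟩
        B (s ℕ.+ u) z s * (D s z * α s * β z)     ∎)
        (∙-cong-∣ (∙-cong-∣ ∣ʳ-refl (hα s u)) ∣ʳ-refl)

      -- Needed when two vertices become one: the last vertex is then replaced by s as well, and the
      -- modulus must be carried back at that end too. The symmetry of `D` reduces this to `B-D`.
      last-∣ : ∀ s b → modulus s b ∣ B b s s * modulus s s
      last-∣ s b with ℕ.≤-<-connex s b
      ... | inj₂ b<s = ∣ʳ-respʳ-≈ (sym (trans (*-congʳ (B-zero s b<s)) (zeroˡ _))) (_ ∣0)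
      ... | inj₁ s≤b with ℕ.m≤n⇒∃[o]m+o≡n s≤b
      ... | u , ≡.refl = ∣ʳ-respʳ-≈ (begin
        D s (s ℕ.+ u) * α s * (choose s u * β s)    ≈⟨ *-congʳ (*-congʳ (D-comm s (s ℕ.+ u))) ⟩
        D (s ℕ.+ u) s * α s * (choose s u * β s)    ≈⟨ solve 4 (λ a b c d → a :* b :* (c :* d) := (a :* c) :* b :* d) refl _ _ _ _ ⟩
        (D (s ℕ.+ u) s * choose s u) * α s * β s    ≈⟨ *-congʳ (*-congʳ (B-D s u s)) ⟨
        B (s ℕ.+ u) s s * D s s * α s * β s         ≈⟨ solve 4 (λ a b c d → a :* b :* c :* d := a :* (b :* c :* d)) refl _ _ _ _ ⟩
        B (s ℕ.+ u) s s * (D s s * α s * β s)       ∎)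
        (∙-cong-∣ ∣ʳ-refl (hβ s u))

      step₃ : ∀ w κ μ a b c l → Convolution a b κ μ → (∀ s → modulus s (final c l) ∣ cycSum w s (c ∷ l)) →
        modulus a (final c l) ∣ cycSum (λ k → μ k * w k) a (b ∷ c ∷ l)
      step₃ w κ μ a b c l H IH = ∣ʳ-respʳ-≈
        (sym (cycSum-step w μ a (b ∷ c ∷ l) (c ∷ l) (λ s → κ s * (B a z s * B b c s)) reduce))
        (∑-∣ a _ _ divides)
        where
        z = final c l
        reduce : ∀ k → k ≤ a → ∑ a (λ s → κ s * (B a z s * B b c s) * cyc s (c ∷ l) k) ≈ μ k * cyc a (b ∷ c ∷ l) k
        reduce k k≤a = begin
          ∑ a (λ s → κ s * (B a z s * B b c s) * ((B s c k * P) * B z s k))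
            ≈⟨ ∑-cong a (λ s _ → solve 4 (λ x y z w → x :* ((y :* z) :* w) := (x :* (y :* w)) :* z) refl _ _ _ _) ⟩
          ∑ a (λ s → κ s * (B a z s * B b c s) * (B s c k * B z s k) * P)
            ≈⟨ trans (∑-*ʳ a P _) (*-congʳ (bailey₃ κ μ H c z k k≤a)) ⟩
          μ k * (B a b k * (B b c k * B z a k)) * P
            ≈⟨ solve 5 (λ m x y z p → m :* (x :* (y :* z)) :* p := m :* ((x :* (y :* p)) :* z)) refl _ _ _ _ _ ⟩
          μ k * ((B a b k * (B b c k * P)) * B z a k) ∎
          where P = path c l k
        divides : ∀ s → s ≤ a → modulus a z ∣ κ s * (B a z s * B b c s) * cycSum w s (c ∷ l)
        divides s s≤a = ∣ʳ-respʳ-≈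
          (solve 4 (λ k x y m → (k :* y) :* (x :* m) := k :* (x :* y) :* m) refl _ _ _ _)
          (x∣ʳy⇒x∣ʳzy (κ s * B b c s) (∣ʳ-trans (first-∣ s a z s≤a) (∙-cong-∣ ∣ʳ-refl (IH s))))

      step₂ : ∀ w κ μ a b → Convolution a b κ μ → (∀ s → modulus s s ∣ cycSum w s []) →
        modulus a b ∣ cycSum (λ k → μ k * w k) a (b ∷ [])
      step₂ w κ μ a b H IH = ∣ʳ-respʳ-≈
        (sym (cycSum-step w μ a (b ∷ []) [] (λ s → κ s * (B a b s * B b s s)) reduce))
        (∑-∣ a _ _ divides)
        where
        reduce : ∀ k → k ≤ a → ∑ a (λ s → κ s * (B a b s * B b s s) * cyc s [] k) ≈ μ k * cyc a (b ∷ []) k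
        reduce k k≤a = begin
          ∑ a (λ s → κ s * (B a b s * B b s s) * (1# * B s s k))
            ≈⟨ ∑-cong a (λ s _ → *-congˡ (*-identityˡ _)) ⟩
          ∑ a (λ s → κ s * (B a b s * B b s s) * B s s k)
            ≈⟨ bailey₂ κ μ H k k≤a ⟩
          μ k * (B a b k * B b a k)
            ≈⟨ *-congˡ (*-congʳ (*-identityʳ _)) ⟨
          μ k * ((B a b k * 1#) * B b a k) ∎
        divides : ∀ s → s ≤ a → modulus a b ∣ κ s * (B a b s * B b s s) * cycSum w s []
        divides s s≤a = ∣ʳ-respʳ-≈
          (solve 4 (λ k x y m → k :* (x :* (y :* m)) := k :* (x :* y) :* m) refl _ _ _ _)
          (x∣ʳy⇒x∣ʳzy (κ s) (∣ʳ-trans (first-∣ s a b s≤a)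
            (∙-cong-∣ ∣ʳ-refl (∣ʳ-trans (last-∣ s b) (∙-cong-∣ ∣ʳ-refl (IH s))))))

      -- A merge with `κ₁` lowers j by one and a merge with `κ₀` is used when j = 0; either way the
      -- list gets shorter by one, so the bound on j survives and the base case meets only j ≤ 1.
      chain-∣ : ∀ w → (∀ j a → j ≤ 1 → modulus a a ∣ cycSum (weight w j) a []) →
        ∀ l a j → j ≤ suc (length l) → modulus a (final a l) ∣ cycSum (weight w j) a l
      chain-∣ w base [] a j j≤1 = base j a j≤1
      chain-∣ w base (b ∷ []) a zero _ = ∣ʳ-respʳ-≈ (cycSum-cong a (b ∷ []) (λ k → *-identityˡ (weight w 0 k)))
        (step₂ (weight w 0) (κ₀ a b) (λ _ → 1#) a b (convolution₀ a b) (λ s → base 0 s z≤n))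
      chain-∣ w base (b ∷ []) a (suc j) (s≤s j≤) = ∣ʳ-respʳ-≈
        (cycSum-cong a (b ∷ []) (λ k → trans (sym (*-assoc _ _ _)) (*-congʳ (sym (^-homo-* q (k ℕ.* k ℕ.+ k) _)))))
        (step₂ (weight w j) κ₁ κ₁ a b (convolution₁ a b) (λ s → base j s j≤))
      chain-∣ w base (b ∷ c ∷ l) a zero _ = ∣ʳ-respʳ-≈ (cycSum-cong a (b ∷ c ∷ l) (λ k → *-identityˡ (weight w 0 k)))
        (step₃ (weight w 0) (κ₀ a b) (λ _ → 1#) a b c l (convolution₀ a b) (λ s → chain-∣ w base (c ∷ l) s 0 z≤n))
      chain-∣ w base (b ∷ c ∷ l) a (suc j) (s≤s j≤) = ∣ʳ-respʳ-≈
        (cycSum-cong a (b ∷ c ∷ l) (λ k → trans (sym (*-assoc _ _ _)) (*-congʳ (sym (^-homo-* q (k ℕ.* k ℕ.+ k) _)))))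
        (step₃ (weight w j) κ₁ κ₁ a b c l (convolution₁ a b) (λ s → chain-∣ w base (c ∷ l) s j j≤))

  -- The sums for m = 1: absorption and telescoping

  module Base (cancel : ∀ n x → [ suc n ] * x ≈ 0# → x ≈ 0#) (p : Carrier) (qp≈1 : q * p ≈ 1#) where
    open Cancellative cancel

    qᵏpᵏ≈1 : ∀ k → q ^ k * p ^ k ≈ 1#
    qᵏpᵏ≈1 zero = *-identityˡ 1#
    qᵏpᵏ≈1 (suc k) = begin
      q * q ^ k * (p * p ^ k)      ≈⟨ solve 4 (λ q a p b → q :* a :* (p :* b) := (q :* p) :* (a :* b)) refl q (q ^ k) p (p ^ k) ⟩
      (q * p) * (q ^ k * p ^ k)    ≈⟨ *-cong qp≈1 (qᵏpᵏ≈1 k) ⟩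
      1# * 1#                      ≈⟨ *-identityˡ 1# ⟩
      1#                           ∎

    pᵏ⁺ᵈqᵈ : ∀ k d → p ^ (k ℕ.+ d) * q ^ d ≈ p ^ k
    pᵏ⁺ᵈqᵈ k d = begin
      p ^ (k ℕ.+ d) * q ^ d      ≈⟨ *-congʳ (^-homo-* p k d) ⟩
      p ^ k * p ^ d * q ^ d      ≈⟨ trans (*-assoc _ _ _) (*-congˡ (*-comm _ _)) ⟩
      p ^ k * (q ^ d * p ^ d)    ≈⟨ trans (*-congˡ (qᵏpᵏ≈1 d)) (*-identityʳ _) ⟩
      p ^ k                      ∎

    absorbˡ : ∀ a b → [ suc a ] * choose (suc a) b ≈ [ suc (a ℕ.+ b) ] * choose a b
    absorbˡ a b = fac-cancel a (fac-cancel b (begin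
      [ suc a ] * choose (suc a) b * fac a * fac b
        ≈⟨ solve 4 (λ x c a b → x :* c :* a :* b := c :* ((x :* a) :* b)) refl _ _ _ _ ⟩
      choose (suc a) b * (fac (suc a) * fac b)          ≈⟨ choose-fac (suc a) b ⟩
      [ suc (a ℕ.+ b) ] * fac (a ℕ.+ b)                 ≈⟨ *-congˡ (choose-fac a b) ⟨
      [ suc (a ℕ.+ b) ] * (choose a b * (fac a * fac b))
        ≈⟨ solve 4 (λ x c a b → x :* (c :* (a :* b)) := x :* c :* a :* b) refl _ _ _ _ ⟩
      [ suc (a ℕ.+ b) ] * choose a b * fac a * fac b ∎))

    absorbʳ : ∀ a b → [ suc b ] * choose a (suc b) ≈ [ suc (a ℕ.+ b) ] * choose a b
    absorbʳ a b = fac-cancel a (fac-cancel b (begin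
      [ suc b ] * choose a (suc b) * fac a * fac b
        ≈⟨ solve 4 (λ x c a b → x :* c :* a :* b := c :* (a :* (x :* b))) refl _ _ _ _ ⟩
      choose a (suc b) * (fac a * fac (suc b))          ≈⟨ choose-fac a (suc b) ⟩
      fac (a ℕ.+ suc b)                                 ≡⟨ ≡.cong fac (ℕ.+-suc a b) ⟩
      [ suc (a ℕ.+ b) ] * fac (a ℕ.+ b)                 ≈⟨ *-congˡ (choose-fac a b) ⟨
      [ suc (a ℕ.+ b) ] * (choose a b * (fac a * fac b))
        ≈⟨ solve 4 (λ x c a b → x :* (c :* (a :* b)) := x :* c :* a :* b) refl _ _ _ _ ⟩
      [ suc (a ℕ.+ b) ] * choose a b * fac a * fac b ∎))

    B-diag : ∀ k d → B (k ℕ.+ d) (k ℕ.+ d) k ≈ choose d (suc (k ℕ.+ (k ℕ.+ d)))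
    B-diag k d = B-choose k d (k ℕ.+ d) _ (ℕ.+-comm _ 1)

    2n+1 : ℕ → Carrier
    2n+1 n = [ suc (n ℕ.+ n) ]

    -- With `B-absorbʳ` this shows that [n+k+1] B(n,n;k) and [n-k] B(n,n;k) are [2n+1] times
    -- neighbouring entries of the row (2n choose n-k), which is what makes telescoping possible.
    B-absorbˡ : ∀ k d → let n = k ℕ.+ d in [ suc (k ℕ.+ n) ] * B n n k ≈ 2n+1 n * low (n ℕ.+ n) n k
    B-absorbˡ k d = begin
      [ suc (k ℕ.+ n) ] * B n n k                             ≈⟨ *-congˡ (B-diag k d) ⟩
      [ suc (k ℕ.+ n) ] * choose d (suc (k ℕ.+ n))            ≈⟨ absorbʳ d (k ℕ.+ n) ⟩
      [ suc (d ℕ.+ (k ℕ.+ n)) ] * choose d (k ℕ.+ n)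
        ≡⟨ ≡.cong (λ x → [ suc x ] * bin x d) (lem k d) ⟩
      2n+1 n * bin (n ℕ.+ n) d                                ≡⟨ ≡.cong (2n+1 n *_) (≡.sym (low-+ (n ℕ.+ n) k d)) ⟩
      2n+1 n * low (n ℕ.+ n) n k                              ∎
      where
      n = k ℕ.+ d
      lem : ∀ k d → d ℕ.+ (k ℕ.+ (k ℕ.+ d)) ≡ k ℕ.+ d ℕ.+ (k ℕ.+ d)
      lem = ℕSolver.solve-∀

    B-absorbʳ : ∀ k d → let n = k ℕ.+ d in [ d ] * B n n k ≈ 2n+1 n * low (n ℕ.+ n) n (suc k)
    B-absorbʳ k zero = trans (zeroˡ _) (sym (trans (*-congˡ (reflexive (low-< _ {k ℕ.+ 0} {suc k} (s≤s (ℕ.≤-reflexive (ℕ.+-identityʳ k)))))) (zeroʳ _)))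
    B-absorbʳ k (suc d) = begin
      [ suc d ] * B n n k                                   ≈⟨ *-congˡ (B-diag k (suc d)) ⟩
      [ suc d ] * choose (suc d) (suc (k ℕ.+ n))            ≈⟨ absorbˡ d (suc (k ℕ.+ n)) ⟩
      [ suc (d ℕ.+ suc (k ℕ.+ n)) ] * choose d (suc (k ℕ.+ n))
        ≡⟨ ≡.cong (λ x → [ suc x ] * bin x d) (lem k d) ⟩
      2n+1 n * bin (n ℕ.+ n) d                              ≡⟨ ≡.cong (2n+1 n *_) (≡.sym (low-+ (n ℕ.+ n) (suc k) d)) ⟩
      2n+1 n * low (n ℕ.+ n) (suc (k ℕ.+ d)) (suc k)        ≡⟨ ≡.cong (λ x → 2n+1 n * low (n ℕ.+ n) x (suc k)) (≡.sym (ℕ.+-suc k d)) ⟩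
      2n+1 n * low (n ℕ.+ n) n (suc k)                      ∎
      where
      n = k ℕ.+ suc d
      lem : ∀ k d → d ℕ.+ suc (k ℕ.+ (k ℕ.+ suc d)) ≡ k ℕ.+ suc d ℕ.+ (k ℕ.+ suc d)
      lem = ℕSolver.solve-∀

    -- One absorption on each side lowers both entries from n+1 to n. This converts the product
    -- [N-k][N+k+1] into a sum of the next smaller size.
    B-descend : ∀ n k d → k ℕ.+ d ≡ suc n →
      [ d ] * [ suc (k ℕ.+ suc n) ] * B (suc n) (suc n) k ≈ 2n+1 (suc n) * [ suc n ℕ.+ suc n ] * B n n k
    B-descend n k zero e = trans (*-congʳ (zeroˡ _)) (trans (zeroˡ _) (sym (trans (*-congˡ (B-zero n n<k)) (zeroʳ _))))
      where
      n<k : n < k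
      n<k = ℕ.≤-reflexive (≡.trans (≡.sym e) (ℕ.+-identityʳ k))
    B-descend n k (suc d) e with ≡.trans (≡.sym (ℕ.+-suc k d)) e
    ... | ≡.refl = begin
      [ suc d ] * [ suc b ] * B N N k
        ≈⟨ *-congˡ (B-choose′) ⟩
      [ suc d ] * [ suc b ] * choose (suc d) (suc b)
        ≈⟨ solve 3 (λ x y z → x :* y :* z := y :* (x :* z)) refl _ _ _ ⟩
      [ suc b ] * ([ suc d ] * choose (suc d) (suc b))
        ≈⟨ *-congˡ (absorbˡ d (suc b)) ⟩
      [ suc b ] * ([ suc (d ℕ.+ suc b) ] * choose d (suc b))
        ≈⟨ solve 3 (λ x y z → y :* (x :* z) := x :* (y :* z)) refl _ _ _ ⟩
      [ suc (d ℕ.+ suc b) ] * ([ suc b ] * choose d (suc b))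
        ≈⟨ *-congˡ (absorbʳ d b) ⟩
      [ suc (d ℕ.+ suc b) ] * ([ suc (d ℕ.+ b) ] * choose d b)
        ≈⟨ *-assoc _ _ _ ⟨
      [ suc (d ℕ.+ suc b) ] * [ suc (d ℕ.+ b) ] * choose d b
        ≈⟨ *-cong (*-cong ([]-cong (lem₁ k d)) ([]-cong (lem₂ k d))) (sym (B-choose k d (k ℕ.+ d) b (lem₃ k d))) ⟩
      2n+1 N * [ N ℕ.+ N ] * B (k ℕ.+ d) (k ℕ.+ d) k ∎
      where
      N = suc (k ℕ.+ d)
      b = k ℕ.+ N
      B-choose′ : B N N k ≈ choose (suc d) (suc b)
      B-choose′ = ≡.subst (λ x → B x x k ≈ choose (suc d) (suc (k ℕ.+ x))) (ℕ.+-suc k d) (B-diag k (suc d))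
      lem₁ : ∀ k d → suc (d ℕ.+ suc (k ℕ.+ suc (k ℕ.+ d))) ≡ suc (suc (k ℕ.+ d) ℕ.+ suc (k ℕ.+ d))
      lem₁ = ℕSolver.solve-∀
      lem₂ : ∀ k d → suc (d ℕ.+ (k ℕ.+ suc (k ℕ.+ d))) ≡ suc (k ℕ.+ d) ℕ.+ suc (k ℕ.+ d)
      lem₂ = ℕSolver.solve-∀
      lem₃ : ∀ k d → k ℕ.+ (k ℕ.+ d) ℕ.+ 1 ≡ k ℕ.+ suc (k ℕ.+ d)
      lem₃ = ℕSolver.solve-∀

    S : (ℕ → Carrier) → ℕ → Carrier
    S w n = ∑ n (λ k → w k * B n n k)

    cycSum-[] : ∀ w n → cycSum w n [] ≈ S w n
    cycSum-[] w n = ∑-cong n (λ k _ → *-congˡ (*-identityˡ _))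

    -- `g` is a telescoping certificate, and the hypothesis is the difference equation with B(n,n;k)
    -- divided out. The boundary term at n+1 vanishes, and the one at 0 is g(0) [2n+1] (2n choose
    -- n), a multiple of D(n,n).
    S-telescope : ∀ n (y g : ℕ → Carrier) →
      (∀ k d → k ℕ.+ d ≡ n → y k + g (suc k) * [ d ] ≈ g k * [ suc (k ℕ.+ n) ]) → S y n ≈ g 0 * D n n
    S-telescope n y g e = begin
      S y n                       ≈⟨ +-identityʳ _ ⟨
      S y n + 0#                  ≈⟨ +-congˡ (trans (*-congˡ (trans (*-congˡ (reflexive (low-< (n ℕ.+ n) (ℕ.n<1+n n)))) (zeroʳ _))) (zeroʳ _)) ⟨
      S y n + G (suc n)           ≈⟨ telescope n (λ k → y k * B n n k) G step ⟩
      G 0                         ≈⟨ *-congˡ (*-congʳ ([]-cong (ℕ.+-comm 1 (n ℕ.+ n)))) ⟩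
      g 0 * D n n                 ∎
      where
      G : ℕ → Carrier
      G k = g k * (2n+1 n * low (n ℕ.+ n) n k)
      step : ∀ k → k ≤ n → y k * B n n k + G (suc k) ≈ G k
      step k k≤n with ℕ.m≤n⇒∃[o]m+o≡n k≤n
      ... | d , ≡.refl = begin
        y k * b + g (suc k) * (2n+1 n * low (n ℕ.+ n) n (suc k))
          ≈⟨ +-congˡ (*-congˡ (B-absorbʳ k d)) ⟨
        y k * b + g (suc k) * ([ d ] * b)
          ≈⟨ solve 4 (λ y g d b → y :* b :+ g :* (d :* b) := (y :+ g :* d) :* b) refl _ _ _ _ ⟩
        (y k + g (suc k) * [ d ]) * b
          ≈⟨ trans (*-congʳ (e k d ≡.refl)) (*-assoc _ _ _) ⟩
        g k * ([ suc (k ℕ.+ n) ] * b)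
          ≈⟨ *-congˡ (B-absorbˡ k d) ⟩
        g k * (2n+1 n * low (n ℕ.+ n) n k) ∎
        where b = B n n k

    -- The same factor as in `B-descend`, now acting on the modulus: it is the source of the square
    -- [n+1]² in the divisibility for r > 0.
    D-descend : ∀ n → 2n+1 (suc n) * [ suc n ℕ.+ suc n ] * D n n ≈ [ suc n ] * [ suc n ] * D (suc n) (suc n)
    D-descend n = fac-cancel n (fac-cancel n (begin
      2n+1 (suc n) * [ N ] * D n n * fac n * fac n
        ≈⟨ solve 4 (λ x y d f → x :* y :* d :* f :* f := x :* (y :* (d :* (f :* f)))) refl _ _ _ _ ⟩
      2n+1 (suc n) * ([ N ] * (D n n * (fac n * fac n)))
        ≈⟨ *-congˡ (*-cong ([]-cong (≡.cong suc (ℕ.+-suc n n))) (D-fac n n)) ⟩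
      2n+1 (suc n) * fac (suc (suc (n ℕ.+ n)))
        ≡⟨ ≡.cong (λ x → 2n+1 (suc n) * fac x) (≡.cong suc (≡.sym (ℕ.+-suc n n))) ⟩
      fac (suc N)
        ≈⟨ D-fac (suc n) (suc n) ⟨
      D (suc n) (suc n) * (fac (suc n) * fac (suc n))
        ≈⟨ solve 3 (λ x d f → d :* ((x :* f) :* (x :* f)) := x :* x :* d :* f :* f) refl _ _ _ ⟩
      [ suc n ] * [ suc n ] * D (suc n) (suc n) * fac n * fac n ∎))
      where N = suc n ℕ.+ suc n

    S-descend : ∀ n (w : ℕ → Carrier) → ∑ (suc n) (λ k → w k * B n n k) ≈ S w n
    S-descend n w = trans (+-congˡ (trans (*-congˡ (B-zero n (ℕ.n<1+n n))) (zeroʳ _))) (+-identityʳ _)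

    rest-+ : ∀ k d → [ suc (k ℕ.+ (k ℕ.+ d)) ] ≈ [ d ] + [ k ℕ.+ suc k ] + h * ([ d ] * [ k ℕ.+ suc k ])
    rest-+ k d = trans ([]-cong (lem k d)) ([]-+ d (k ℕ.+ suc k))
      where
      lem : ∀ k d → suc (k ℕ.+ (k ℕ.+ d)) ≡ d ℕ.+ (k ℕ.+ suc k)
      lem = ℕSolver.solve-∀

    -- With h = q - 1, every [·] and power of q below is a polynomial in h, [k] and [d], where n = k + d.
    product-split : ∀ k d → let n = k ℕ.+ d in [ n ] * [ suc n ] ≈ q ^ d * ([ k ] * [ suc k ]) + [ d ] * [ suc (k ℕ.+ n) ]
    product-split k d = begin
      [ k ℕ.+ d ] * (1# + q * [ k ℕ.+ d ])
        ≈⟨ *-cong ([]-+ k d) (+-congˡ (*-congˡ ([]-+ k d))) ⟩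
      (a + b + h * (a * b)) * (1# + q * (a + b + h * (a * b)))
        ≈⟨ solve 3 (λ h a b →
             let a⁺ = con 1 :+ (con 1 :+ h) :* a ; K = a :+ a⁺ :+ h :* (a :* a⁺) ; n = a :+ b :+ h :* (a :* b) in
             n :* (con 1 :+ (con 1 :+ h) :* n) := (con 1 :+ h :* b) :* (a :* a⁺) :+ b :* (b :+ K :+ h :* (b :* K)))
             refl h a b ⟩
      (1# + h * b) * (a * [ suc k ]) + b * (b + K + h * (b * K))
        ≈⟨ +-cong (*-congʳ (q^ d)) (*-congˡ (trans (rest-+ k d) (+-cong (+-congˡ ([]-+ k (suc k))) (*-congˡ (*-congˡ ([]-+ k (suc k))))))) ⟨
      q ^ d * (a * [ suc k ]) + b * [ suc (k ℕ.+ (k ℕ.+ d)) ] ∎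
      where
      a = [ k ]
      b = [ d ]
      K = a + [ suc k ] + h * (a * [ suc k ])

    -- The recurrence in r

    odd : ℕ → Carrier
    odd k = [ k ℕ.+ suc k ]

    powered : (ℕ → Carrier) → ℕ → ℕ → Carrier
    powered u r k = u k * ([ k ] * [ suc k ] * p ^ k) ^ r

    -- `product-split` multiplied by q^(-N) and summed: since p^N q^(N-k) = p^k, its first part
    -- raises r by one, and `B-descend` turns the second into the sum of size n. The term of size n
    -- stays on the left to avoid subtraction.
    S-suc : ∀ u r n → let N = suc n in
      S (powered u (suc r)) N + p ^ N * (2n+1 N * [ N ℕ.+ N ]) * S (powered u r) n ≈ p ^ N * ([ N ] * [ suc N ]) * S (powered u r) N
    S-suc u r n = begin
      S (powered u (suc r)) N + x * S (powered u r) n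
        ≈⟨ +-congˡ (*-congˡ (S-descend n (powered u r))) ⟨
      S (powered u (suc r)) N + x * ∑ N (λ k → powered u r k * B n n k)
        ≈⟨ trans (∑-+ N _ _) (+-congˡ (∑-*ˡ N x _)) ⟨
      ∑ N (λ k → powered u (suc r) k * B N N k + x * (powered u r k * B n n k))
        ≈⟨ ∑-cong N term ⟩
      ∑ N (λ k → y * (powered u r k * B N N k))
        ≈⟨ ∑-*ˡ N y _ ⟩
      y * S (powered u r) N ∎
      where
      N = suc n
      x = p ^ N * (2n+1 N * [ N ℕ.+ N ])
      y = p ^ N * ([ N ] * [ suc N ])
      term : ∀ k → k ≤ N → powered u (suc r) k * B N N k + x * (powered u r k * B n n k) ≈ y * (powered u r k * B N N k)
      term k k≤N with ℕ.m≤n⇒∃[o]m+o≡n k≤N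
      ... | d , e = begin
        u k * (([ k ] * [ suc k ] * p ^ k) * P) * B N N k + x * (u k * P * B n n k)
          ≈⟨ solve 8 (λ u kk pk P b pN m b′ → u :* ((kk :* pk) :* P) :* b :+ pN :* m :* (u :* P :* b′)
               := u :* P :* (kk :* pk :* b :+ pN :* (m :* b′))) refl
               (u k) ([ k ] * [ suc k ]) (p ^ k) P (B N N k) (p ^ N) (2n+1 N * [ N ℕ.+ N ]) (B n n k) ⟩
        u k * P * ([ k ] * [ suc k ] * p ^ k * B N N k + p ^ N * (2n+1 N * [ N ℕ.+ N ] * B n n k))
          ≈⟨ *-congˡ (+-cong (*-congʳ (*-congˡ (≡.subst (λ m → p ^ m * q ^ d ≈ p ^ k) e (pᵏ⁺ᵈqᵈ k d)))) (*-congˡ (B-descend n k d e))) ⟨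
        u k * P * ([ k ] * [ suc k ] * (p ^ N * q ^ d) * B N N k + p ^ N * ([ d ] * [ suc (k ℕ.+ N) ] * B N N k))
          ≈⟨ solve 6 (λ uP kk pN qd m b → uP :* (kk :* (pN :* qd) :* b :+ pN :* (m :* b)) := pN :* (qd :* kk :+ m) :* (uP :* b)) refl
               (u k * P) ([ k ] * [ suc k ]) (p ^ N) (q ^ d) ([ d ] * [ suc (k ℕ.+ N) ]) (B N N k) ⟩
        p ^ N * (q ^ d * ([ k ] * [ suc k ]) + [ d ] * [ suc (k ℕ.+ N) ]) * (u k * P * B N N k)
          ≈⟨ *-congʳ (*-congˡ (≡.subst (λ m → [ m ] * [ suc m ] ≈ q ^ d * ([ k ] * [ suc k ]) + [ d ] * [ suc (k ℕ.+ m) ]) e (product-split k d))) ⟨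
        y * (powered u r k * B N N k) ∎
        where P = ([ k ] * [ suc k ] * p ^ k) ^ r

    S-zero : ∀ u r → S (powered u (suc r)) 0 ≈ 0#
    S-zero u r = trans (*-congʳ (trans (*-congˡ (trans (*-congʳ (trans (*-congʳ (zeroˡ _)) (zeroˡ _))) (zeroˡ _))) (zeroʳ _))) (zeroˡ _)

    ∣-cancel-+ : ∀ {x y z w} → y + z ≈ w → x ∣ z → x ∣ w → x ∣ y
    ∣-cancel-+ {x} {y} {z} {w} e (z′ , ez) (w′ , ew) = w′ - z′ , +-cancelʳ z _ _ (begin
      (w′ - z′) * x + z             ≈⟨ +-congˡ ez ⟨
      (w′ - z′) * x + z′ * x        ≈⟨ distribʳ x _ _ ⟨
      (w′ - z′ + z′) * x            ≈⟨ *-congʳ (trans (+-assoc _ _ _) (trans (+-congˡ (-‿inverseˡ z′)) (+-identityʳ w′))) ⟩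
      w′ * x                        ≈⟨ ew ⟩
      w                             ≈⟨ e ⟨
      y + z                         ∎)

    -- `f` is the part of the second factor [N] that the sum for r already has. In `S-suc` the term
    -- of size n carries [N]² D(N,N) by `D-descend`, and the other carries [N] f(N) D(N,N); as f(N)
    -- divides [N], both are multiples of the new modulus.
    powered-∣ : ∀ u r (f : ℕ → Carrier) → (∀ n → D n n ∣ S (powered u r) n) →
      (∀ n → D (suc n) (suc n) * f (suc n) ∣ S (powered u r) (suc n)) → (∀ n → f (suc n) ∣ [ suc n ]) →
      ∀ n → D n n * f n * [ n ] ∣ S (powered u (suc r)) n
    powered-∣ u r f d d′ f∣ zero = ∣ʳ-respʳ-≈ (sym (S-zero u r)) (_ ∣0)
    powered-∣ u r f d d′ f∣ (suc n) = ∣-cancel-+ (S-suc u r n) upper lower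
      where
      N = suc n
      rearrange : p ^ N * [ N ] * ([ N ] * D N N) ≈ p ^ N * ([ N ] * [ N ] * D N N)
      rearrange = solve 3 (λ p x d → p :* x :* (x :* d) := p :* (x :* x :* d)) refl (p ^ N) [ N ] (D N N)
      upper : D N N * f N * [ N ] ∣ p ^ N * (2n+1 N * [ N ℕ.+ N ]) * S (powered u r) n
      upper = ∣ʳ-trans (∙-cong-∣ (∙-cong-∣ ∣ʳ-refl (f∣ n)) ∣ʳ-refl) (∣ʳ-trans
        (∣ʳ-reflexive (solve 2 (λ d x → d :* x :* x := x :* x :* d) refl (D N N) [ N ]))
        (∣ʳ-respˡ-≈ (D-descend n) (∣ʳ-respʳ-≈ (sym (*-assoc _ _ _))
          (x∣ʳy⇒x∣ʳzy (p ^ N) (∙-cong-∣ ∣ʳ-refl (d n))))))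
      lower : D N N * f N * [ N ] ∣ p ^ N * ([ N ] * [ suc N ]) * S (powered u r) N
      lower = ∣ʳ-respʳ-≈
        (solve 4 (λ p x y s → p :* y :* (s :* x) := p :* (x :* y) :* s) refl (p ^ N) [ N ] [ suc N ] (S (powered u r) N))
        (x∣ʳy⇒x∣ʳzy (p ^ N * [ suc N ]) (∙-cong-∣ (d′ n) ∣ʳ-refl))

    drop-∣ : ∀ {x y z} → x * y ∣ z → x ∣ z
    drop-∣ {x} {y} (w , e) = w * y , trans (solve 3 (λ w y x → w :* y :* x := w :* (x :* y)) refl w y x) e

    powered-∣₁ : ∀ u → (∀ n → D n n ∣ S (powered u 0) n) → ∀ r n → D n n * [ n ] ∣ S (powered u (suc r)) n
    powered-∣₁ u d zero n = ∣ʳ-respˡ-≈ (*-congʳ (*-identityʳ _))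
      (powered-∣ u 0 (λ _ → 1#) d (λ n → ∣ʳ-respˡ-≈ (sym (*-identityʳ _)) (d (suc n))) (λ n → 1∣ _) n)
    powered-∣₁ u d (suc r) n = ∣ʳ-respˡ-≈ (*-congʳ (*-identityʳ _))
      (powered-∣ u (suc r) (λ _ → 1#) (λ n → drop-∣ (powered-∣₁ u d r n))
        (λ n → ∣ʳ-respˡ-≈ (sym (*-identityʳ _)) (drop-∣ (powered-∣₁ u d r (suc n)))) (λ n → 1∣ _) n)

    -- The second [n] appears one step after the first, because the term of unchanged size must
    -- already contain one [n] before it gains another.
    powered-∣₂ : ∀ u → (∀ n → D n n ∣ S (powered u 0) n) → ∀ r n → D n n * [ n ] * [ n ] ∣ S (powered u (suc (suc r))) n
    powered-∣₂ u d r = powered-∣ u (suc r) [_] (λ n → drop-∣ (powered-∣₁ u d r n))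
      (λ n → powered-∣₁ u d r (suc n)) (λ n → ∣ʳ-refl)

    -- For the alternating weights, whose sums have a factor [n] at r = 0, both factors are present
    -- from r = 1 on.
    powered-∣₃ : ∀ u → (∀ n → D n n ∣ S (powered u 0) n) → (∀ n → D (suc n) (suc n) * [ suc n ] ∣ S (powered u 0) (suc n)) →
      ∀ r n → D n n * [ n ] * [ n ] ∣ S (powered u (suc r)) n
    powered-∣₃ u d d′ zero = powered-∣ u 0 [_] d d′ (λ n → ∣ʳ-refl)
    powered-∣₃ u d d′ (suc r) = powered-∣₂ u d r

    S-cong : ∀ n {w w′} → (∀ k → w k ≈ w′ k) → S w n ≈ S w′ n
    S-cong n e = ∑-cong n (λ k _ → *-congʳ (e k))

    q^[k²+k]pᵏ : ∀ k → q ^ (k ℕ.* k ℕ.+ k) * p ^ k ≈ q ^ (k ℕ.* k)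
    q^[k²+k]pᵏ k = begin
      q ^ (k ℕ.* k ℕ.+ k) * p ^ k            ≈⟨ trans (*-congʳ (^-homo-* q (k ℕ.* k) k)) (*-assoc _ _ _) ⟩
      q ^ (k ℕ.* k) * (q ^ k * p ^ k)        ≈⟨ trans (*-congˡ (qᵏpᵏ≈1 k)) (*-identityʳ _) ⟩
      q ^ (k ℕ.* k)                          ∎

    -- The sums for r = 0 in the first congruence

    -- The exponent -(r+1)k is divided between this weight, which takes -k, and `powered`, which
    -- takes -rk.
    u₁ : ℕ → Carrier
    u₁ k = p ^ k * odd k

    -- The certificate is the constant q^(-n): since q^(-k) = q^(-n) q^d, the equation reads [k+n+1]
    -- = q^d [2k+1] + [d].
    S-u₁ : ∀ n → S u₁ n ≈ p ^ n * D n n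
    S-u₁ n = S-telescope n u₁ (λ _ → p ^ n) step
      where
      step : ∀ k d → k ℕ.+ d ≡ n → p ^ k * odd k + p ^ n * [ d ] ≈ p ^ n * [ suc (k ℕ.+ n) ]
      step k d ≡.refl = begin
        p ^ k * odd k + p ^ (k ℕ.+ d) * [ d ]
          ≈⟨ +-congʳ (*-congʳ (trans (*-congˡ (sym (q^ d))) (pᵏ⁺ᵈqᵈ k d))) ⟨
        p ^ (k ℕ.+ d) * (1# + h * [ d ]) * odd k + p ^ (k ℕ.+ d) * [ d ]
          ≈⟨ solve 4 (λ p h d o → p :* (con 1 :+ h :* d) :* o :+ p :* d := p :* (d :+ o :+ h :* (d :* o))) refl _ _ _ _ ⟩
        p ^ (k ℕ.+ d) * ([ d ] + odd k + h * ([ d ] * odd k))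
          ≈⟨ *-congˡ (rest-+ k d) ⟨
        p ^ (k ℕ.+ d) * [ suc (k ℕ.+ (k ℕ.+ d)) ] ∎

    -- The certificate is q^(k²): its successive ratio is q^(2k+1), and [k+n+1] = [2k+1] + q^(2k+1)
    -- [d].
    S-u₁-quadratic : ∀ n → S (λ k → q ^ (k ℕ.* k ℕ.+ k) * u₁ k) n ≈ D n n
    S-u₁-quadratic n = trans (S-telescope n _ (λ k → q ^ (k ℕ.* k)) step) (*-identityˡ _)
      where
      lem : ∀ k → suc k ℕ.* suc k ≡ k ℕ.* k ℕ.+ (k ℕ.+ suc k)
      lem = ℕSolver.solve-∀
      step : ∀ k d → k ℕ.+ d ≡ n → q ^ (k ℕ.* k ℕ.+ k) * (p ^ k * odd k) + q ^ (suc k ℕ.* suc k) * [ d ] ≈ q ^ (k ℕ.* k) * [ suc (k ℕ.+ n) ]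
      step k d ≡.refl = begin
        q ^ (k ℕ.* k ℕ.+ k) * (p ^ k * odd k) + q ^ (suc k ℕ.* suc k) * [ d ]
          ≈⟨ +-cong (trans (sym (*-assoc _ _ _)) (*-congʳ (q^[k²+k]pᵏ k)))
               (*-congʳ (trans (^-congʳ q (lem k)) (trans (^-homo-* q (k ℕ.* k) (k ℕ.+ suc k)) (*-congˡ (q^ (k ℕ.+ suc k)))))) ⟩
        Q * odd k + Q * (1# + h * odd k) * [ d ]
          ≈⟨ solve 4 (λ Q h d o → Q :* o :+ Q :* (con 1 :+ h :* o) :* d := Q :* (d :+ o :+ h :* (d :* o))) refl _ _ _ _ ⟩
        Q * ([ d ] + odd k + h * ([ d ] * odd k))
          ≈⟨ *-congˡ (rest-+ k d) ⟨
        Q * [ suc (k ℕ.+ (k ℕ.+ d)) ] ∎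
        where Q = q ^ (k ℕ.* k)

    -- The alternating sums for r = 0

    ε : Carrier
    ε = - 1#

    u₂ : ℕ → Carrier
    u₂ k = ε ^ k * q ^ (k C 2) * odd k

    alternate : ∀ {x y z} → x ≈ z + y → x + ε * y ≈ z
    alternate {x} {y} {z} e = begin
      x + ε * y              ≈⟨ +-congʳ e ⟩
      z + y + ε * y          ≈⟨ solve 3 (λ z y e → z :+ y :+ e :* y := z :+ (con 1 :+ e) :* y) refl z y ε ⟩
      z + (1# + ε) * y       ≈⟨ +-congˡ (trans (*-congʳ (-‿inverseʳ 1#)) (zeroˡ y)) ⟩
      z + 0#                 ≈⟨ +-identityʳ z ⟩
      z                      ∎

    sucC2 : ∀ k → suc k C 2 ≡ k ℕ.+ k C 2
    sucC2 k = ≡.trans (≡.sym (nCk+nC[k+1]≡[n+1]C[k+1] k 1)) (≡.cong (ℕ._+ k C 2) (nC1≡n k))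

    -- The certificate is for [N] times the summand, which is why [N] is cancelled at the end. It
    -- contains the factor [k], so the boundary term at 0 vanishes. The sum of size 0 is 1, hence
    -- the restriction to a successor.
    S-u₂ : ∀ n → S u₂ (suc n) ≈ 0#
    S-u₂ n = cancel n _ (begin
      [ N ] * S u₂ N                     ≈⟨ ∑-*ˡ N [ N ] _ ⟨
      ∑ N (λ k → [ N ] * (u₂ k * B N N k))  ≈⟨ ∑-cong N (λ k _ → sym (*-assoc _ _ _)) ⟩
      S (λ k → [ N ] * u₂ k) N           ≈⟨ S-telescope N _ (λ k → ε ^ k * q ^ (k C 2) * [ k ]) step ⟩
      1# * q ^ (0 C 2) * 0# * D N N      ≈⟨ trans (*-congʳ (zeroʳ _)) (zeroˡ _) ⟩
      0#                                 ∎)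
      where
      N = suc n
      split : ∀ k d → k ℕ.+ d ≡ N → [ N ] * odd k ≈ [ k ] * [ suc (k ℕ.+ N) ] + q ^ k * [ suc k ] * [ d ]
      split k d e = ≡.subst (λ n → [ n ] * odd k ≈ [ k ] * [ suc (k ℕ.+ n) ] + q ^ k * [ suc k ] * [ d ]) e (begin
        [ k ℕ.+ d ] * odd k
          ≈⟨ *-cong ([]-+ k d) ([]-+ k (suc k)) ⟩
        (a + b + h * (a * b)) * K
          ≈⟨ solve 3 (λ h a b →
               let a⁺ = con 1 :+ (con 1 :+ h) :* a ; K = a :+ a⁺ :+ h :* (a :* a⁺) in
               (a :+ b :+ h :* (a :* b)) :* K := a :* (b :+ K :+ h :* (b :* K)) :+ (con 1 :+ h :* a) :* a⁺ :* b)
               refl h a b ⟩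
        a * (b + K + h * (b * K)) + (1# + h * a) * [ suc k ] * b
          ≈⟨ +-cong (*-congˡ (trans (rest-+ k d) (+-cong (+-congˡ ([]-+ k (suc k))) (*-congˡ (*-congˡ ([]-+ k (suc k)))))))
               (*-congʳ (*-congʳ (q^ k))) ⟨
        a * [ suc (k ℕ.+ (k ℕ.+ d)) ] + q ^ k * [ suc k ] * b ∎)
        where
        a = [ k ]
        b = [ d ]
        K = a + [ suc k ] + h * (a * [ suc k ])
      step : ∀ k d → k ℕ.+ d ≡ N → [ N ] * u₂ k + ε ^ suc k * q ^ (suc k C 2) * [ suc k ] * [ d ] ≈ ε ^ k * q ^ (k C 2) * [ k ] * [ suc (k ℕ.+ N) ]
      step k d e = begin
        [ N ] * (E * Q * odd k) + ε * E * q ^ (suc k C 2) * [ suc k ] * [ d ]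
          ≈⟨ +-congˡ (*-congʳ (*-congʳ (*-congˡ (trans (^-congʳ q (sucC2 k)) (^-homo-* q k (k C 2)))))) ⟩
        [ N ] * (E * Q * odd k) + ε * E * (q ^ k * Q) * [ suc k ] * [ d ]
          ≈⟨ solve 8 (λ n E Q o e qk k⁺ d → n :* (E :* Q :* o) :+ e :* E :* (qk :* Q) :* k⁺ :* d
               := E :* Q :* (n :* o :+ e :* (qk :* k⁺ :* d))) refl [ N ] E Q (odd k) ε (q ^ k) [ suc k ] [ d ] ⟩
        E * Q * ([ N ] * odd k + ε * (q ^ k * [ suc k ] * [ d ]))
          ≈⟨ trans (*-congˡ (alternate (split k d e))) (sym (*-assoc _ _ _)) ⟩
        E * Q * [ k ] * [ suc (k ℕ.+ N) ] ∎
        where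
        E = ε ^ k
        Q = q ^ (k C 2)

    u₂-quadratic : ℕ → Carrier
    u₂-quadratic k = q ^ (k ℕ.* k ℕ.+ k) * u₂ k

    -- In closed form S u₂-quadratic n = (1-q)⋯(1-qⁿ) D n n; the recurrence in n comes from a telescoping (WZ) pair.
    S-u₂-quadratic : ∀ n → let N = suc n in [ N ] * S u₂-quadratic N + h * (2n+1 N * [ N ℕ.+ N ]) * S u₂-quadratic n ≈ 0#
    S-u₂-quadratic n = begin
      [ N ] * S w N + x * S w n
        ≈⟨ +-congˡ (*-congˡ (S-descend n w)) ⟨
      [ N ] * S w N + x * ∑ N (λ k → w k * B n n k)
        ≈⟨ +-cong (∑-*ˡ N [ N ] _) (∑-*ˡ N x _) ⟨
      ∑ N (λ k → [ N ] * (w k * B N N k)) + ∑ N (λ k → x * (w k * B n n k))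
        ≈⟨ ∑-+ N _ _ ⟨
      ∑ N (λ k → [ N ] * (w k * B N N k) + x * (w k * B n n k))
        ≈⟨ ∑-cong N collect ⟩
      S y N
        ≈⟨ S-telescope N y g step ⟩
      γ 0 * (q ^ N * 1# * 0#) * D N N
        ≈⟨ trans (*-congʳ (trans (*-congˡ (zeroʳ _)) (zeroʳ _))) (zeroˡ _) ⟩
      0# ∎
      where
      N = suc n
      w = u₂-quadratic
      x = h * (2n+1 N * [ N ℕ.+ N ])
      γ y g : ℕ → Carrier
      γ k = ε ^ k * (q ^ (k C 2) * q ^ (k ℕ.* k ℕ.+ k))
      -- `B-descend` puts the summand of size n over `B N N k`, and this is the weight that results.
      -- In the certificate below, q^N p^k stands for q^(N-k), and the factor [k] makes the boundary
      -- term at 0 vanish.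
      y k = w k * ([ N ] + h * ([ N ∸ k ] * [ suc (k ℕ.+ N) ]))
      g k = γ k * (q ^ N * p ^ k * [ k ])
      collect : ∀ k → k ≤ N → [ N ] * (w k * B N N k) + x * (w k * B n n k) ≈ y k * B N N k
      collect k k≤N = begin
        [ N ] * (w k * B N N k) + h * m * (w k * B n n k)
          ≈⟨ solve 6 (λ n w b h m b′ → n :* (w :* b) :+ h :* m :* (w :* b′) := w :* (n :* b :+ h :* (m :* b′))) refl _ _ _ _ _ _ ⟩
        w k * ([ N ] * B N N k + h * (m * B n n k))
          ≈⟨ *-congˡ (+-congˡ (*-congˡ (B-descend n k (N ∸ k) (ℕ.m+[n∸m]≡n k≤N)))) ⟨
        w k * ([ N ] * B N N k + h * ([ N ∸ k ] * [ suc (k ℕ.+ N) ] * B N N k))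
          ≈⟨ solve 6 (λ w n b h d o → w :* (n :* b :+ h :* (d :* o :* b)) := w :* (n :+ h :* (d :* o)) :* b) refl _ _ _ _ _ _ ⟩
        y k * B N N k ∎
        where m = 2n+1 N * [ N ℕ.+ N ]
      γ-suc : ∀ k → γ (suc k) ≈ ε * (γ k * (q * (q * (q ^ k * (q ^ k * q ^ k)))))
      γ-suc k = begin
        ε * ε ^ k * (q ^ (suc k C 2) * q ^ (suc k ℕ.* suc k ℕ.+ suc k))
          ≈⟨ *-congˡ (*-cong (trans (^-congʳ q (sucC2 k)) (^-homo-* q k (k C 2)))
               (trans (^-congʳ q (lem k)) (trans (^-homo-* q (k ℕ.* k ℕ.+ k) _) (*-congˡ (*-congˡ (*-congˡ (^-homo-* q k k))))))) ⟩
        ε * ε ^ k * (q ^ k * q ^ (k C 2) * (q ^ (k ℕ.* k ℕ.+ k) * (q * (q * (q ^ k * q ^ k)))))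
          ≈⟨ solve 6 (λ e E a b d q → e :* E :* (a :* b :* (d :* (q :* (q :* (a :* a))))) := e :* (E :* (b :* d) :* (q :* (q :* (a :* (a :* a)))))) refl
               ε (ε ^ k) (q ^ k) (q ^ (k C 2)) (q ^ (k ℕ.* k ℕ.+ k)) q ⟩
        ε * (γ k * (q * (q * (q ^ k * (q ^ k * q ^ k))))) ∎
        where
        lem : ∀ k → suc k ℕ.* suc k ℕ.+ suc k ≡ (k ℕ.* k ℕ.+ k) ℕ.+ suc (suc (k ℕ.+ k))
        lem = ℕSolver.solve-∀
      split : ∀ k d → k ℕ.+ d ≡ N → odd k * ([ N ] + h * ([ d ] * [ suc (k ℕ.+ N) ]))
        ≈ q ^ d * [ k ] * [ suc (k ℕ.+ N) ] + q * (q ^ k * (q ^ k * q ^ k)) * q ^ d * [ suc k ] * [ d ]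
      split k d e = ≡.subst (λ n → odd k * ([ n ] + h * ([ d ] * [ suc (k ℕ.+ n) ]))
        ≈ q ^ d * [ k ] * [ suc (k ℕ.+ n) ] + q * (q ^ k * (q ^ k * q ^ k)) * q ^ d * [ suc k ] * [ d ]) e (begin
        odd k * ([ k ℕ.+ d ] + h * (b * [ suc (k ℕ.+ (k ℕ.+ d)) ]))
          ≈⟨ *-cong ([]-+ k (suc k)) (+-cong ([]-+ k d) (*-congˡ (*-congˡ rest))) ⟩
        K * (a + b + h * (a * b) + h * (b * (b + K + h * (b * K))))
          ≈⟨ solve 3 (λ h a b →
               let a⁺ = con 1 :+ (con 1 :+ h) :* a ; K = a :+ a⁺ :+ h :* (a :* a⁺) ; r = b :+ K :+ h :* (b :* K)
                   Q = con 1 :+ h :* a ; Qd = con 1 :+ h :* b in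
               K :* (a :+ b :+ h :* (a :* b) :+ h :* (b :* r)) := Qd :* a :* r :+ (con 1 :+ h) :* (Q :* (Q :* Q)) :* Qd :* a⁺ :* b)
               refl h a b ⟩
        (1# + h * b) * a * (b + K + h * (b * K)) + q * (Q′ * (Q′ * Q′)) * (1# + h * b) * [ suc k ] * b
          ≈⟨ +-cong (*-cong (*-congʳ (q^ d)) rest)
               (*-congʳ (*-congʳ (*-cong (*-congˡ (*-cong (q^ k) (*-cong (q^ k) (q^ k)))) (q^ d)))) ⟨
        q ^ d * a * [ suc (k ℕ.+ (k ℕ.+ d)) ] + q * (q ^ k * (q ^ k * q ^ k)) * q ^ d * [ suc k ] * b ∎)
        where
        a = [ k ]
        b = [ d ]
        K = a + [ suc k ] + h * (a * [ suc k ])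
        Q′ = 1# + h * a
        rest : [ suc (k ℕ.+ (k ℕ.+ d)) ] ≈ b + K + h * (b * K)
        rest = trans (rest-+ k d) (+-cong (+-congˡ ([]-+ k (suc k))) (*-congˡ (*-congˡ ([]-+ k (suc k)))))
      qᴺpᵏ : ∀ k d → k ℕ.+ d ≡ N → q ^ N * p ^ k ≈ q ^ d
      qᴺpᵏ k d e = begin
        q ^ N * p ^ k                  ≈⟨ *-congʳ (trans (^-congʳ q (≡.sym e)) (^-homo-* q k d)) ⟩
        q ^ k * q ^ d * p ^ k          ≈⟨ solve 3 (λ x y z → x :* y :* z := y :* (x :* z)) refl _ _ _ ⟩
        q ^ d * (q ^ k * p ^ k)        ≈⟨ trans (*-congˡ (qᵏpᵏ≈1 k)) (*-identityʳ _) ⟩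
        q ^ d                          ∎
      step : ∀ k d → k ℕ.+ d ≡ N → y k + g (suc k) * [ d ] ≈ g k * [ suc (k ℕ.+ N) ]
      step k d e = begin
        y k + γ (suc k) * (q ^ N * (p * p ^ k) * [ suc k ]) * [ d ]
          ≈⟨ +-cong (*-cong (solve 4 (λ q E Q o → q :* (E :* Q :* o) := E :* (Q :* q) :* o) refl _ _ _ _)
                 (+-congˡ (*-congˡ (*-congʳ ([]-cong (≡.trans (≡.cong (_∸ k) (≡.sym e)) (ℕ.m+n∸m≡n k d)))))))
               (*-congʳ (*-congʳ (γ-suc k))) ⟩
        γ k * odd k * X + ε * (γ k * (q * (q * Q))) * (q ^ N * (p * p ^ k) * [ suc k ]) * [ d ]
          ≈⟨ solve 11 (λ c o X e q Q qN p pk k⁺ d → c :* o :* X :+ e :* (c :* (q :* (q :* Q))) :* (qN :* (p :* pk) :* k⁺) :* d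
               := c :* (o :* X :+ e :* ((q :* p) :* (q :* Q :* (qN :* pk) :* k⁺ :* d)))) refl
               (γ k) (odd k) X ε q Q (q ^ N) p (p ^ k) [ suc k ] [ d ] ⟩
        γ k * (odd k * X + ε * ((q * p) * (q * Q * (q ^ N * p ^ k) * [ suc k ] * [ d ])))
          ≈⟨ *-congˡ (+-congˡ (*-congˡ (trans (*-cong qp≈1 (*-congʳ (*-congʳ (*-congˡ (qᴺpᵏ k d e))))) (*-identityˡ _)))) ⟩
        γ k * (odd k * X + ε * (q * Q * q ^ d * [ suc k ] * [ d ]))
          ≈⟨ *-congˡ (alternate (split k d e)) ⟩
        γ k * (q ^ d * [ k ] * [ suc (k ℕ.+ N) ])
          ≈⟨ trans (sym (*-assoc _ _ _)) (*-congʳ (*-congˡ (*-congʳ (sym (qᴺpᵏ k d e))))) ⟩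
        g k * [ suc (k ℕ.+ N) ] ∎
        where
        X = [ N ] + h * ([ d ] * [ suc (k ℕ.+ N) ])
        Q = q ^ k * (q ^ k * q ^ k)

    D00∣ : ∀ x → D 0 0 ∣ x
    D00∣ x = x , trans (*-congˡ (trans (*-identityʳ _) (trans (+-congˡ (zeroʳ q)) (+-identityʳ 1#)))) (*-identityʳ x)

    -- If the sum of size n is x D(n,n), the recurrence and `D-descend` make [N] times the next sum
    -- equal to -h x [N]² D(N,N). Cancelling one [N] leaves the other, with quotient -h x.
    S-u₂-quadratic-∣ : ∀ n → D n n ∣ S u₂-quadratic n → D (suc n) (suc n) * [ suc n ] ∣ S u₂-quadratic (suc n)
    S-u₂-quadratic-∣ n (x , e) = - (h * x) , []-cancel n (begin
      [ N ] * (- (h * x) * (D N N * [ N ]))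
        ≈⟨ solve 3 (λ a y d → a :* (y :* (d :* a)) := y :* (a :* a :* d)) refl [ N ] (- (h * x)) (D N N) ⟩
      - (h * x) * ([ N ] * [ N ] * D N N)
        ≈⟨ *-congˡ (D-descend n) ⟨
      - (h * x) * (m * D n n)
        ≈⟨ -‿distribˡ-* (h * x) _ ⟨
      - (h * x * (m * D n n))
        ≈⟨ -‿cong (trans (solve 4 (λ h x m d → h :* x :* (m :* d) := h :* m :* (x :* d)) refl h x m (D n n)) (*-congˡ e)) ⟩
      - (h * m * S u₂-quadratic n)
        ≈⟨ +-inverseˡ-unique _ _ (S-u₂-quadratic n) ⟨
      [ N ] * S u₂-quadratic N ∎)
      where
      N = suc n
      m = 2n+1 N * [ N ℕ.+ N ]

    -- Assembling the moduli

    -- For s > 0, [s] (s+u choose s) = [s+u] (s+u-1 choose s-1). Squares would not do for Laurent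
    -- polynomials: at s = u = 1 the binomial is only [2].
    []-∣ : ∀ e → e ≤ 1 → ∀ s u → [ s ℕ.+ u ] ^ e ∣ choose s u * [ s ] ^ e
    []-∣ zero _ s u = 1∣ _
    []-∣ (suc zero) _ zero u = ∣ʳ-respʳ-≈ (sym (trans (*-congˡ (zeroˡ _)) (zeroʳ _))) (_ ∣0)
    []-∣ (suc zero) _ (suc s) u = choose s u , (begin
      choose s u * ([ suc (s ℕ.+ u) ] * 1#)      ≈⟨ trans (*-congˡ (*-identityʳ _)) (*-comm _ _) ⟩
      [ suc (s ℕ.+ u) ] * choose s u             ≈⟨ absorbˡ s u ⟨
      [ suc s ] * choose (suc s) u               ≈⟨ trans (*-comm _ _) (*-congˡ (sym (*-identityʳ _))) ⟩
      choose (suc s) u * ([ suc s ] * 1#)        ∎)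
    []-∣ (suc (suc e)) (s≤s ()) s u

    modulus-∣ : ∀ n w {z} e f → e ≤ 1 → f ≤ 1 → S w n ≈ z → D n n * [ n ] * [ n ] ∣ S w n → D n n * [ n ] ^ e * [ n ] ^ f ∣ z
    modulus-∣ n w e f e≤1 f≤1 eq d = ∣ʳ-respʳ-≈ eq (∣ʳ-trans (∙-cong-∣ (∙-cong-∣ ∣ʳ-refl (lem e e≤1)) (lem f f≤1)) d)
      where
      lem : ∀ e → e ≤ 1 → [ n ] ^ e ∣ [ n ]
      lem zero _ = 1∣ _
      lem (suc zero) _ = ∣ʳ-reflexive (*-identityʳ _)
      lem (suc (suc e)) (s≤s ())

    powered-0 : ∀ v n → S (powered v 0) n ≈ S v n
    powered-0 v n = S-cong n (λ k → *-identityʳ (v k))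

    weight-0 : ∀ u k → weight u 0 k ≈ u k
    weight-0 u k = *-identityˡ (u k)

    weight-1 : ∀ u k → weight u 1 k ≈ q ^ (k ℕ.* k ℕ.+ k) * u k
    weight-1 u k = *-congʳ (^-congʳ q (ℕ.+-identityʳ (k ℕ.* k ℕ.+ k)))

    weight-powered : ∀ u r j n → S (powered (weight u j) r) n ≈ cycSum (weight (powered u r) j) n []
    weight-powered u r j n = trans (S-cong n (λ k → *-assoc _ _ _)) (sym (cycSum-[] (weight (powered u r) j) n))

    u₁-∣ : ∀ j n → j ≤ 1 → D n n ∣ S (powered (weight u₁ j) 0) n
    u₁-∣ zero n _ = p ^ n , sym (trans (powered-0 (weight u₁ 0) n) (trans (S-cong n (weight-0 u₁)) (S-u₁ n)))
    u₁-∣ (suc zero) n _ = ∣ʳ-reflexive (sym (trans (powered-0 (weight u₁ 1) n) (trans (S-cong n (weight-1 u₁)) (S-u₁-quadratic n))))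
    u₁-∣ (suc (suc j)) n (s≤s ())

    u₂-quadratic-∣ : ∀ n → D n n ∣ S u₂-quadratic n
    u₂-quadratic-∣ zero = D00∣ _
    u₂-quadratic-∣ (suc n) = drop-∣ (S-u₂-quadratic-∣ n (u₂-quadratic-∣ n))

    u₂-∣′ : ∀ j n → j ≤ 1 → D (suc n) (suc n) * [ suc n ] ∣ S (powered (weight u₂ j) 0) (suc n)
    u₂-∣′ zero n _ = ∣ʳ-respʳ-≈ (sym (trans (powered-0 (weight u₂ 0) (suc n)) (trans (S-cong (suc n) (weight-0 u₂)) (S-u₂ n)))) (_ ∣0)
    u₂-∣′ (suc zero) n _ = ∣ʳ-respʳ-≈ (sym (trans (powered-0 (weight u₂ 1) (suc n)) (S-cong (suc n) (weight-1 u₂))))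
      (S-u₂-quadratic-∣ n (u₂-quadratic-∣ n))
    u₂-∣′ (suc (suc j)) n (s≤s ())

    u₂-∣ : ∀ j n → j ≤ 1 → D n n ∣ S (powered (weight u₂ j) 0) n
    u₂-∣ j zero _ = D00∣ _
    u₂-∣ j (suc n) j≤1 = drop-∣ (u₂-∣′ j n j≤1)

    module Exponents (e f : ℕ) (e≤1 : e ≤ 1) (f≤1 : f ≤ 1) =
      Chain (λ n → [ n ] ^ e) (λ n → [ n ] ^ f) ([]-∣ e e≤1) ([]-∣ f f≤1)

    chain₁ : ∀ r l a j → j ≤ suc (length l) →
      D a (final a l) * [ a ] ^ (1 ℕ.⊓ r) * [ final a l ] ^ (1 ℕ.⊓ (r C 2)) ∣ cycSum (weight (powered u₁ r) j) a l
    chain₁ r = E.chain-∣ (powered u₁ r) (base r)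
      where
      module E = Exponents (1 ℕ.⊓ r) (1 ℕ.⊓ (r C 2)) (ℕ.m⊓n≤m 1 r) (ℕ.m⊓n≤m 1 (r C 2))
      base : ∀ r j n → j ≤ 1 → D n n * [ n ] ^ (1 ℕ.⊓ r) * [ n ] ^ (1 ℕ.⊓ (r C 2)) ∣ cycSum (weight (powered u₁ r) j) n []
      base zero j n j≤1 = ∣ʳ-respʳ-≈ (weight-powered u₁ 0 j n)
        (∣ʳ-respˡ-≈ (sym (trans (*-identityʳ _) (*-identityʳ _))) (u₁-∣ j n j≤1))
      base (suc zero) j n j≤1 = ∣ʳ-respʳ-≈ (weight-powered u₁ 1 j n)
        (∣ʳ-respˡ-≈ (sym (trans (*-identityʳ _) (*-congˡ (*-identityʳ _)))) (powered-∣₁ (weight u₁ j) (λ n → u₁-∣ j n j≤1) 0 n))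
      -- From r = 2 on both factors [n] are available, so it is enough that the exponent with `C 2`
      -- is at most 1; its value need not be computed.
      base (suc (suc r)) j n j≤1 = modulus-∣ n (powered (weight u₁ j) (suc (suc r))) 1 (1 ℕ.⊓ (suc (suc r) C 2)) ℕ.≤-refl (ℕ.m⊓n≤m 1 (suc (suc r) C 2)) (weight-powered u₁ (suc (suc r)) j n)
        (powered-∣₂ (weight u₁ j) (λ n → u₁-∣ j n j≤1) r n)

    chain₂ : ∀ r l a j → j ≤ suc (length l) →
      D a (final a l) * [ a ] ^ (1 ℕ.⊓ r) * [ final a l ] ^ (1 ℕ.⊓ r) ∣ cycSum (weight (powered u₂ r) j) a l
    chain₂ r = E.chain-∣ (powered u₂ r) (base r)
      where
      module E = Exponents (1 ℕ.⊓ r) (1 ℕ.⊓ r) (ℕ.m⊓n≤m 1 r) (ℕ.m⊓n≤m 1 r)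
      base : ∀ r j n → j ≤ 1 → D n n * [ n ] ^ (1 ℕ.⊓ r) * [ n ] ^ (1 ℕ.⊓ r) ∣ cycSum (weight (powered u₂ r) j) n []
      base zero j n j≤1 = ∣ʳ-respʳ-≈ (weight-powered u₂ 0 j n)
        (∣ʳ-respˡ-≈ (sym (trans (*-identityʳ _) (*-identityʳ _))) (u₂-∣ j n j≤1))
      base (suc r) j n j≤1 = modulus-∣ n (powered (weight u₂ j) (suc r)) 1 1 ℕ.≤-refl ℕ.≤-refl (weight-powered u₂ (suc r) j n)
        (powered-∣₃ (weight u₂ j) (λ n → u₂-∣ j n j≤1) (λ n → u₂-∣′ j n j≤1) r n)

    -- From indexed products and integer arguments to cycles

    ∏ : ∀ m → (Fin m → Carrier) → Carrier
    ∏ zero f = 1#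
    ∏ (suc m) f = f Fin.zero * ∏ m (λ i → f (Fin.suc i))

    ∏-cong : ∀ m {f g} → (∀ i → f i ≈ g i) → ∏ m f ≈ ∏ m g
    ∏-cong zero e = refl
    ∏-cong (suc m) e = *-cong (e Fin.zero) (∏-cong m (λ i → e (Fin.suc i)))

    -- The closing vertex `c` is separate from `n Fin.zero`, because the induction drops the first
    -- vertex while the last factor still returns to the original one.
    ∏-path : ∀ m (n N : Fin (suc m) → ℕ) c k → (∀ i → N (Fin.inject₁ i) ≡ n (Fin.suc i)) → N (Fin.fromℕ m) ≡ c →
      let l = tabulate (λ i → n (Fin.suc i)) in
      ∏ (suc m) (λ i → B (n i) (N i) k) ≈ path (n Fin.zero) l k * B (final (n Fin.zero) l) c k
    ∏-path zero n N c k inner ≡.refl = *-comm _ _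
    ∏-path (suc m) n N c k inner last rewrite inner Fin.zero = trans
      (*-congˡ (∏-path m (λ i → n (Fin.suc i)) (λ i → N (Fin.suc i)) c k (λ i → inner (Fin.suc i)) last))
      (sym (*-assoc _ _ _))

    final-tabulate : ∀ m (n : Fin (suc m) → ℕ) → final (n Fin.zero) (tabulate (λ i → n (Fin.suc i))) ≡ n (Fin.fromℕ m)
    final-tabulate zero n = ≡.refl
    final-tabulate (suc m) n = final-tabulate m (λ i → n (Fin.suc i))

    -- Kept over the abstract ring, where an equality determines its two sides; the pointwise ≈L does not.
    module Transfer
      (I : ℕ → Carrier) (I≈ : ∀ n → I n ≈ [ n ])
      (b : ℕ → ℤ → Carrier) (b-+ : ∀ n k → b n (+ k) ≈ bin n k) (b-neg : ∀ n k → b n -[1+ k ] ≈ 0#)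
      (Q : ℤ → Carrier) (Q≈ : ∀ m n → Q (+ m ℤ.- + n) ≈ q ^ m * p ^ n) where

      b-low : ∀ N a k → b N (+ a ℤ.- + k) ≈ low N a k
      b-low N a k = trans (reflexive (≡.cong (b N) (ℤ.m-n≡m⊖n a k))) (⊖-low a k)
        where
        ⊖-low : ∀ a k → b N (a ℤ.⊖ k) ≈ low N a k
        ⊖-low a zero = b-+ N a
        ⊖-low zero (suc k) = b-neg N k
        ⊖-low (suc a) (suc k) = trans (reflexive (≡.cong (b N) (ℤ.[1+m]⊖[1+n]≡m⊖n a k))) (⊖-low a k)

      module _ (m : ℕ) (n N : Fin (suc m) → ℕ) (inner : ∀ i → N (Fin.inject₁ i) ≡ n (Fin.suc i))
        (last : N (Fin.fromℕ m) ≡ n Fin.zero) (j r : ℕ) (j≤ : j ≤ suc m) where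

        a z : ℕ
        a = n Fin.zero
        z = n (Fin.fromℕ m)

        P : ℕ → Carrier
        P k = ∏ (suc m) (λ i → b (n i ℕ.+ N i ℕ.+ 1) (+ n i ℤ.- + k))

        l : List ℕ
        l = tabulate (λ i → n (Fin.suc i))

        P≈ : ∀ k → P k ≈ cyc a l k
        P≈ k = trans (∏-cong (suc m) (λ i → b-low (n i ℕ.+ N i ℕ.+ 1) (n i) k)) (∏-path m n N a k inner last)

        modulus≈ : ∀ e f → D a (final a l) * [ a ] ^ e * [ final a l ] ^ f
          ≈ I (a ℕ.+ z ℕ.+ 1) * b (a ℕ.+ z) (+ a) * I a ^ e * I z ^ f
        modulus≈ e f rewrite final-tabulate m n = sym
          (*-cong (*-cong (*-cong (I≈ (a ℕ.+ z ℕ.+ 1)) (b-+ (a ℕ.+ z) a)) (^-congˡ e (I≈ a))) (^-congˡ f (I≈ z)))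

        I-powers : ∀ k → I k ^ r * I (k ℕ.+ 1) ^ r * p ^ (r ℕ.* k) ≈ ([ k ] * [ suc k ] * p ^ k) ^ r
        I-powers k = begin
          I k ^ r * I (k ℕ.+ 1) ^ r * p ^ (r ℕ.* k)
            ≈⟨ *-cong (*-cong (^-congˡ r (I≈ k)) (^-congˡ r (trans (I≈ (k ℕ.+ 1)) ([]-cong (ℕ.+-comm k 1)))))
                 (trans (^-congʳ p (ℕ.*-comm r k)) (sym (^-assocʳ p k r))) ⟩
          [ k ] ^ r * [ suc k ] ^ r * (p ^ k) ^ r
            ≈⟨ trans (^-distrib-* _ _ r) (*-congʳ (^-distrib-* _ _ r)) ⟨
          ([ k ] * [ suc k ] * p ^ k) ^ r ∎

        I-odd : ∀ k → I (2 ℕ.* k ℕ.+ 1) ≈ odd k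
        I-odd k = trans (I≈ (2 ℕ.* k ℕ.+ 1)) ([]-cong (lem k))
          where
          lem : ∀ k → 2 ℕ.* k ℕ.+ 1 ≡ k ℕ.+ suc k
          lem = ℕSolver.solve-∀

        j≤length : j ≤ suc (length l)
        j≤length = ≡.subst (λ x → j ≤ suc x) (≡.sym (length-tabulate (λ i → n (Fin.suc i)))) j≤

        transfer₁ : I (a ℕ.+ z ℕ.+ 1) * b (a ℕ.+ z) (+ a) * I a ^ (1 ℕ.⊓ r) * I z ^ (1 ℕ.⊓ (r C 2))
          ∣ ∑ a (λ k → Q (+ (j ℕ.* (k ℕ.* k ℕ.+ k)) ℤ.- + ((r ℕ.+ 1) ℕ.* k)) * I (2 ℕ.* k ℕ.+ 1) * I k ^ r * I (k ℕ.+ 1) ^ r * P k)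
        transfer₁ = ∣ʳ-respˡ-≈ (modulus≈ (1 ℕ.⊓ r) (1 ℕ.⊓ (r C 2)))
          (∣ʳ-respʳ-≈ (sym (∑-cong a (λ k _ → *-cong (term k) (P≈ k)))) (chain₁ r l a j j≤length))
          where
          lem : ∀ r k → (r ℕ.+ 1) ℕ.* k ≡ k ℕ.+ r ℕ.* k
          lem = ℕSolver.solve-∀
          term : ∀ k → Q (+ (j ℕ.* (k ℕ.* k ℕ.+ k)) ℤ.- + ((r ℕ.+ 1) ℕ.* k)) * I (2 ℕ.* k ℕ.+ 1) * I k ^ r * I (k ℕ.+ 1) ^ r
            ≈ weight (powered u₁ r) j k
          term k = begin
            Q (+ e ℤ.- + ((r ℕ.+ 1) ℕ.* k)) * I (2 ℕ.* k ℕ.+ 1) * x * y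
              ≈⟨ *-congʳ (*-congʳ (*-cong (trans (Q≈ e ((r ℕ.+ 1) ℕ.* k)) (*-congˡ (trans (^-congʳ p (lem r k)) (^-homo-* p k (r ℕ.* k))))) (I-odd k))) ⟩
            q ^ e * (p ^ k * p ^ (r ℕ.* k)) * odd k * x * y
              ≈⟨ solve 6 (λ qe pk prk o x y → qe :* (pk :* prk) :* o :* x :* y := qe :* (pk :* o :* (x :* y :* prk))) refl _ _ _ _ _ _ ⟩
            q ^ e * (p ^ k * odd k * (x * y * p ^ (r ℕ.* k)))
              ≈⟨ *-congˡ (*-congˡ (I-powers k)) ⟩
            weight (powered u₁ r) j k ∎
            where
            e = j ℕ.* (k ℕ.* k ℕ.+ k)
            x = I k ^ r
            y = I (k ℕ.+ 1) ^ r

        transfer₂ : I (a ℕ.+ z ℕ.+ 1) * b (a ℕ.+ z) (+ a) * I a ^ (1 ℕ.⊓ r) * I z ^ (1 ℕ.⊓ r)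
          ∣ ∑ a (λ k → ε ^ k * Q (+ (k C 2 ℕ.+ j ℕ.* (k ℕ.* k ℕ.+ k)) ℤ.- + (r ℕ.* k)) * I (2 ℕ.* k ℕ.+ 1) * I k ^ r * I (k ℕ.+ 1) ^ r * P k)
        transfer₂ = ∣ʳ-respˡ-≈ (modulus≈ (1 ℕ.⊓ r) (1 ℕ.⊓ r))
          (∣ʳ-respʳ-≈ (sym (∑-cong a (λ k _ → *-cong (term k) (P≈ k)))) (chain₂ r l a j j≤length))
          where
          term : ∀ k → ε ^ k * Q (+ (k C 2 ℕ.+ j ℕ.* (k ℕ.* k ℕ.+ k)) ℤ.- + (r ℕ.* k)) * I (2 ℕ.* k ℕ.+ 1) * I k ^ r * I (k ℕ.+ 1) ^ r
            ≈ weight (powered u₂ r) j k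
          term k = begin
            ε ^ k * Q (+ (k C 2 ℕ.+ e) ℤ.- + (r ℕ.* k)) * I (2 ℕ.* k ℕ.+ 1) * x * y
              ≈⟨ *-congʳ (*-congʳ (*-cong (*-congˡ (trans (Q≈ (k C 2 ℕ.+ e) (r ℕ.* k)) (*-congʳ (^-homo-* q (k C 2) e)))) (I-odd k))) ⟩
            ε ^ k * (q ^ (k C 2) * q ^ e * p ^ (r ℕ.* k)) * odd k * x * y
              ≈⟨ solve 7 (λ E qc qe prk o x y → E :* (qc :* qe :* prk) :* o :* x :* y := qe :* (E :* qc :* o :* (x :* y :* prk))) refl _ _ _ _ _ _ _ ⟩
            q ^ e * (ε ^ k * q ^ (k C 2) * odd k * (x * y * p ^ (r ℕ.* k)))
              ≈⟨ *-congˡ (*-congˡ (I-powers k)) ⟩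
            weight (powered u₂ r) j k ∎
            where
            e = j ℕ.* (k ℕ.* k ℕ.+ k)
            x = I k ^ r
            y = I (k ℕ.+ 1) ^ r

-- The ring of Laurent polynomials

open ≡ using (refl; sym; trans; cong; cong₂; subst; _≗_)
open ≡.≡-Reasoning

-- Coefficient functions on the integers

at : Poly → ℤ → ℤ
at p (+ n) = nth p n
at p -[1+ n ] = ℤ.0ℤ

coeff-at : ∀ s p i → coeff (lp s p) i ≡ at p (i ℤ.- s)
coeff-at s p i with i ℤ.- s
... | + n = refl
... | -[1+ n ] = refl

at-[] : ∀ i → at [] i ≡ ℤ.0ℤ
at-[] (+ n) = refl
at-[] -[1+ n ] = refl

δ : ℤ → ℤ
δ = at (ℤ.1ℤ ∷ [])

at-∷ : ∀ a p i → at (a ∷ p) i ≡ a ℤ.* δ i ℤ.+ at p (i ℤ.- ℤ.1ℤ)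
at-∷ a p (+ zero) = sym (trans (ℤ.+-identityʳ _) (ℤ.*-identityʳ a))
at-∷ a p (+ suc n) = sym (trans (cong (ℤ._+ nth p n) (ℤ.*-zeroʳ a)) (ℤ.+-identityˡ _))
at-∷ a p -[1+ n ] = sym (trans (ℤ.+-identityʳ _) (ℤ.*-zeroʳ a))

at-padd : ∀ p p′ i → at (padd p p′) i ≡ at p i ℤ.+ at p′ i
at-padd [] p′ i = sym (trans (cong (ℤ._+ at p′ i) (at-[] i)) (ℤ.+-identityˡ _))
at-padd (a ∷ p) [] i = sym (trans (cong (ℤ._+_ (at (a ∷ p) i)) (at-[] i)) (ℤ.+-identityʳ _))
at-padd (a ∷ p) (b ∷ p′) (+ zero) = refl
at-padd (a ∷ p) (b ∷ p′) (+ suc n) = at-padd p p′ (+ n)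
at-padd (a ∷ p) (b ∷ p′) -[1+ n ] = refl

at-pscale : ∀ c p i → at (pscale c p) i ≡ c ℤ.* at p i
at-pscale c [] i = sym (trans (cong (c ℤ.*_) (at-[] i)) (trans (ℤ.*-zeroʳ c) (sym (at-[] i))))
at-pscale c (a ∷ p) (+ zero) = refl
at-pscale c (a ∷ p) (+ suc n) = at-pscale c p (+ n)
at-pscale c (a ∷ p) -[1+ n ] = sym (ℤ.*-zeroʳ c)

at-pshift : ∀ n p i → at (pshift n p) i ≡ at p (i ℤ.- + n)
at-pshift zero p i = cong (at p) (sym (ℤ.+-identityʳ i))
at-pshift (suc n) p i = begin
  at (ℤ.0ℤ ∷ pshift n p) i                      ≡⟨ at-∷ ℤ.0ℤ (pshift n p) i ⟩
  ℤ.0ℤ ℤ.* δ i ℤ.+ at (pshift n p) (i ℤ.- ℤ.1ℤ)   ≡⟨ ℤ.+-identityˡ _ ⟩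
  at (pshift n p) (i ℤ.- ℤ.1ℤ)                  ≡⟨ at-pshift n p (i ℤ.- ℤ.1ℤ) ⟩
  at p (i ℤ.- ℤ.1ℤ ℤ.- + n)                     ≡⟨ cong (at p) (lem i (+ n)) ⟩
  at p (i ℤ.- + suc n)                        ∎
  where
  lem : ∀ i n → i ℤ.- ℤ.1ℤ ℤ.- n ≡ i ℤ.- (ℤ.1ℤ ℤ.+ n)
  lem = solve-∀

-- The polynomial p = Σₖ aₖ qᵏ as the operator Σₖ aₖ Eᵏ on functions ℤ → ℤ, where (E f) i = f (i - 1).
act : Poly → (ℤ → ℤ) → ℤ → ℤ
act [] f i = ℤ.0ℤ
act (a ∷ p) f i = a ℤ.* f i ℤ.+ act p f (i ℤ.- ℤ.1ℤ)

act-cong : ∀ p {f g} → f ≗ g → act p f ≗ act p g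
act-cong [] e i = refl
act-cong (a ∷ p) e i = cong₂ (λ x y → a ℤ.* x ℤ.+ y) (e i) (act-cong p e _)

act-0 : ∀ p {f} → (∀ i → f i ≡ ℤ.0ℤ) → ∀ i → act p f i ≡ ℤ.0ℤ
act-0 [] e i = refl
act-0 (a ∷ p) e i = trans (cong₂ (λ x y → a ℤ.* x ℤ.+ y) (e i) (act-0 p e _)) (trans (ℤ.+-identityʳ _) (ℤ.*-zeroʳ a))

act-+ : ∀ p f g i → act p (λ x → f x ℤ.+ g x) i ≡ act p f i ℤ.+ act p g i
act-+ [] f g i = refl
act-+ (a ∷ p) f g i = trans (cong (ℤ._+_ (a ℤ.* (f i ℤ.+ g i))) (act-+ p f g _)) (lem a (f i) (g i) _ _)
  where
  lem : ∀ a x y z w → a ℤ.* (x ℤ.+ y) ℤ.+ (z ℤ.+ w) ≡ (a ℤ.* x ℤ.+ z) ℤ.+ (a ℤ.* y ℤ.+ w)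
  lem = solve-∀

act-* : ∀ p c f i → act p (λ x → c ℤ.* f x) i ≡ c ℤ.* act p f i
act-* [] c f i = sym (ℤ.*-zeroʳ c)
act-* (a ∷ p) c f i = trans (cong (ℤ._+_ (a ℤ.* (c ℤ.* f i))) (act-* p c f _)) (lem a c (f i) _)
  where
  lem : ∀ a c x z → a ℤ.* (c ℤ.* x) ℤ.+ c ℤ.* z ≡ c ℤ.* (a ℤ.* x ℤ.+ z)
  lem = solve-∀

act-shift : ∀ p f t i → act p (λ x → f (x ℤ.- t)) i ≡ act p f (i ℤ.- t)
act-shift [] f t i = refl
act-shift (a ∷ p) f t i = cong (ℤ._+_ (a ℤ.* f (i ℤ.- t)))
  (trans (act-shift p f t (i ℤ.- ℤ.1ℤ)) (cong (act p f) (lem i t)))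
  where
  lem : ∀ i t → i ℤ.- ℤ.1ℤ ℤ.- t ≡ i ℤ.- t ℤ.- ℤ.1ℤ
  lem = solve-∀

act-padd : ∀ p p′ f i → act (padd p p′) f i ≡ act p f i ℤ.+ act p′ f i
act-padd [] p′ f i = sym (ℤ.+-identityˡ _)
act-padd (a ∷ p) [] f i = sym (ℤ.+-identityʳ _)
act-padd (a ∷ p) (b ∷ p′) f i =
  trans (cong (ℤ._+_ ((a ℤ.+ b) ℤ.* f i)) (act-padd p p′ f _)) (lem a b (f i) _ _)
  where
  lem : ∀ a b x z w → (a ℤ.+ b) ℤ.* x ℤ.+ (z ℤ.+ w) ≡ (a ℤ.* x ℤ.+ z) ℤ.+ (b ℤ.* x ℤ.+ w)
  lem = solve-∀

act-pscale : ∀ c p f i → act (pscale c p) f i ≡ c ℤ.* act p f i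
act-pscale c [] f i = sym (ℤ.*-zeroʳ c)
act-pscale c (a ∷ p) f i = trans (cong (ℤ._+_ (c ℤ.* a ℤ.* f i)) (act-pscale c p f _)) (lem c a (f i) _)
  where
  lem : ∀ c a x z → c ℤ.* a ℤ.* x ℤ.+ c ℤ.* z ≡ c ℤ.* (a ℤ.* x ℤ.+ z)
  lem = solve-∀

-- Multiplication becomes composition of operators, which makes the associativity of the product a
-- formality.
act-pmul : ∀ p p′ f i → act (pmul p p′) f i ≡ act p (act p′ f) i
act-pmul [] p′ f i = refl
act-pmul (a ∷ p) p′ f i = begin
  act (padd (pscale a p′) (ℤ.0ℤ ∷ pmul p p′)) f i
    ≡⟨ act-padd (pscale a p′) (ℤ.0ℤ ∷ pmul p p′) f i ⟩
  act (pscale a p′) f i ℤ.+ (ℤ.0ℤ ℤ.+ act (pmul p p′) f (i ℤ.- ℤ.1ℤ))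
    ≡⟨ cong₂ ℤ._+_ (act-pscale a p′ f i) (trans (ℤ.+-identityˡ _) (act-pmul p p′ f _)) ⟩
  a ℤ.* act p′ f i ℤ.+ act p (act p′ f) (i ℤ.- ℤ.1ℤ) ∎

-- Each operator is linear and commutes with the shift, and the other operator is a combination of
-- shifts.
act-comm : ∀ p p′ f i → act p (act p′ f) i ≡ act p′ (act p f) i
act-comm [] p′ f i = sym (act-0 p′ (λ _ → refl) i)
act-comm (a ∷ p) p′ f i = begin
  a ℤ.* act p′ f i ℤ.+ act p (act p′ f) (i ℤ.- ℤ.1ℤ)
    ≡⟨ cong₂ ℤ._+_ (sym (act-* p′ a f i)) (trans (act-comm p p′ f _) (sym (act-shift p′ (act p f) ℤ.1ℤ i))) ⟩
  act p′ (λ x → a ℤ.* f x) i ℤ.+ act p′ (λ x → act p f (x ℤ.- ℤ.1ℤ)) i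
    ≡⟨ sym (act-+ p′ _ _ i) ⟩
  act p′ (act (a ∷ p) f) i ∎

-- The unit impulse recovers the coefficients from the operator, so identities between operators
-- descend to polynomials.
act-δ : ∀ p i → act p δ i ≡ at p i
act-δ [] i = sym (at-[] i)
act-δ (a ∷ p) i = trans (cong (ℤ._+_ (a ℤ.* δ i)) (act-δ p _)) (sym (at-∷ a p i))

at-pmul : ∀ p p′ i → at (pmul p p′) i ≡ act p (at p′) i
at-pmul p p′ i = trans (sym (act-δ (pmul p p′) i)) (trans (act-pmul p p′ δ i) (act-cong p (act-δ p′) i))

-- The ring laws, coefficient by coefficient

coeff-⊕ : ∀ A B i → coeff (A ⊕ B) i ≡ coeff A i ℤ.+ coeff B i
coeff-⊕ (lp s p) (lp t p′) i = begin
  coeff (lp s p ⊕ lp t p′) i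
    ≡⟨ coeff-at u _ i ⟩
  at (padd (pshift ℤ.∣ s ℤ.- u ∣ p) (pshift ℤ.∣ t ℤ.- u ∣ p′)) (i ℤ.- u)
    ≡⟨ at-padd (pshift ℤ.∣ s ℤ.- u ∣ p) _ (i ℤ.- u) ⟩
  at (pshift ℤ.∣ s ℤ.- u ∣ p) (i ℤ.- u) ℤ.+ at (pshift ℤ.∣ t ℤ.- u ∣ p′) (i ℤ.- u)
    ≡⟨ cong₂ ℤ._+_ (realign s p (ℤ.i⊓j≤i s t)) (realign t p′ (ℤ.i⊓j≤j s t)) ⟩
  coeff (lp s p) i ℤ.+ coeff (lp t p′) i ∎
  where
  u = s ℤ.⊓ t
  lem : ∀ i u s → i ℤ.- u ℤ.- (s ℤ.- u) ≡ i ℤ.- s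
  lem = solve-∀
  realign : ∀ s p → u ℤ.≤ s → at (pshift ℤ.∣ s ℤ.- u ∣ p) (i ℤ.- u) ≡ coeff (lp s p) i
  realign s p u≤s = begin
    at (pshift ℤ.∣ s ℤ.- u ∣ p) (i ℤ.- u)      ≡⟨ at-pshift ℤ.∣ s ℤ.- u ∣ p (i ℤ.- u) ⟩
    at p (i ℤ.- u ℤ.- + ℤ.∣ s ℤ.- u ∣)         ≡⟨ cong (λ x → at p (i ℤ.- u ℤ.- x)) (ℤ.0≤i⇒+∣i∣≡i (ℤ.i≤j⇒0≤j-i u≤s)) ⟩
    at p (i ℤ.- u ℤ.- (s ℤ.- u))             ≡⟨ cong (at p) (lem i u s) ⟩
    at p (i ℤ.- s)                           ≡⟨ sym (coeff-at s p i) ⟩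
    coeff (lp s p) i                         ∎

coeff-⊖ : ∀ A i → coeff (⊖ A) i ≡ ℤ.- coeff A i
coeff-⊖ (lp s p) i = begin
  coeff (⊖ lp s p) i             ≡⟨ coeff-at s _ i ⟩
  at (pscale ℤ.-1ℤ p) (i ℤ.- s)    ≡⟨ at-pscale ℤ.-1ℤ p (i ℤ.- s) ⟩
  ℤ.-1ℤ ℤ.* at p (i ℤ.- s)         ≡⟨ ℤ.-1*i≡-i _ ⟩
  ℤ.- at p (i ℤ.- s)             ≡⟨ cong ℤ.-_ (sym (coeff-at s p i)) ⟩
  ℤ.- coeff (lp s p) i           ∎

-- The right factor enters only through its coefficient function, so the product respects `≈L` on
-- the right at once, and on the left by commutativity.
coeff-⊗ : ∀ s p B i → coeff (lp s p ⊗ B) i ≡ act p (coeff B) (i ℤ.- s)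
coeff-⊗ s p (lp t p′) i = begin
  coeff (lp (s ℤ.+ t) (pmul p p′)) i           ≡⟨ coeff-at (s ℤ.+ t) _ i ⟩
  at (pmul p p′) (i ℤ.- (s ℤ.+ t))             ≡⟨ at-pmul p p′ _ ⟩
  act p (at p′) (i ℤ.- (s ℤ.+ t))              ≡⟨ cong (act p (at p′)) (lem i s t) ⟩
  act p (at p′) (i ℤ.- s ℤ.- t)                ≡⟨ sym (act-shift p (at p′) t (i ℤ.- s)) ⟩
  act p (λ x → at p′ (x ℤ.- t)) (i ℤ.- s)      ≡⟨ act-cong p (λ x → sym (coeff-at t p′ x)) _ ⟩
  act p (coeff (lp t p′)) (i ℤ.- s)            ∎
  where
  lem : ∀ i s t → i ℤ.- (s ℤ.+ t) ≡ i ℤ.- s ℤ.- t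
  lem = solve-∀

⊗-comm : ∀ A B → A ⊗ B ≈L B ⊗ A
⊗-comm (lp s p) (lp t p′) i = begin
  coeff (lp s p ⊗ lp t p′) i                   ≡⟨ coeff-at (s ℤ.+ t) _ i ⟩
  at (pmul p p′) (i ℤ.- (s ℤ.+ t))             ≡⟨ comm (i ℤ.- (s ℤ.+ t)) ⟩
  at (pmul p′ p) (i ℤ.- (s ℤ.+ t))             ≡⟨ cong (λ x → at (pmul p′ p) (i ℤ.- x)) (ℤ.+-comm s t) ⟩
  at (pmul p′ p) (i ℤ.- (t ℤ.+ s))             ≡⟨ sym (coeff-at (t ℤ.+ s) _ i) ⟩
  coeff (lp t p′ ⊗ lp s p) i                   ∎
  where
  comm : ∀ i → at (pmul p p′) i ≡ at (pmul p′ p) i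
  comm i = begin
    at (pmul p p′) i     ≡⟨ sym (act-δ (pmul p p′) i) ⟩
    act (pmul p p′) δ i  ≡⟨ act-pmul p p′ δ i ⟩
    act p (act p′ δ) i   ≡⟨ act-comm p p′ δ i ⟩
    act p′ (act p δ) i   ≡⟨ sym (act-pmul p′ p δ i) ⟩
    act (pmul p′ p) δ i  ≡⟨ act-δ (pmul p′ p) i ⟩
    at (pmul p′ p) i     ∎

⊗-assoc : ∀ A B E → (A ⊗ B) ⊗ E ≈L A ⊗ (B ⊗ E)
⊗-assoc (lp s p) (lp t p′) E i = begin
  coeff ((lp s p ⊗ lp t p′) ⊗ E) i                       ≡⟨ coeff-⊗ (s ℤ.+ t) (pmul p p′) E i ⟩
  act (pmul p p′) (coeff E) (i ℤ.- (s ℤ.+ t))            ≡⟨ act-pmul p p′ (coeff E) _ ⟩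
  act p (act p′ (coeff E)) (i ℤ.- (s ℤ.+ t))             ≡⟨ cong (act p (act p′ (coeff E))) (lem i s t) ⟩
  act p (act p′ (coeff E)) (i ℤ.- s ℤ.- t)               ≡⟨ sym (act-shift p (act p′ (coeff E)) t (i ℤ.- s)) ⟩
  act p (λ x → act p′ (coeff E) (x ℤ.- t)) (i ℤ.- s)     ≡⟨ act-cong p (λ x → sym (coeff-⊗ t p′ E x)) _ ⟩
  act p (coeff (lp t p′ ⊗ E)) (i ℤ.- s)                  ≡⟨ sym (coeff-⊗ s p (lp t p′ ⊗ E) i) ⟩
  coeff (lp s p ⊗ (lp t p′ ⊗ E)) i                       ∎
  where
  lem : ∀ i s t → i ℤ.- (s ℤ.+ t) ≡ i ℤ.- s ℤ.- t
  lem = solve-∀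

⊗-congˡ : ∀ A {B B′} → B ≈L B′ → A ⊗ B ≈L A ⊗ B′
⊗-congˡ (lp s p) {B} {B′} e i =
  trans (coeff-⊗ s p B i) (trans (act-cong p e _) (sym (coeff-⊗ s p B′ i)))

⊗-cong : ∀ {A A′ B B′} → A ≈L A′ → B ≈L B′ → A ⊗ B ≈L A′ ⊗ B′
⊗-cong {A} {A′} {B} {B′} e e′ i = begin
  coeff (A ⊗ B) i    ≡⟨ ⊗-congˡ A e′ i ⟩
  coeff (A ⊗ B′) i   ≡⟨ ⊗-comm A B′ i ⟩
  coeff (B′ ⊗ A) i   ≡⟨ ⊗-congˡ B′ e i ⟩
  coeff (B′ ⊗ A′) i  ≡⟨ ⊗-comm B′ A′ i ⟩
  coeff (A′ ⊗ B′) i  ∎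

⊗-distribˡ : ∀ A B E → A ⊗ (B ⊕ E) ≈L (A ⊗ B) ⊕ (A ⊗ E)
⊗-distribˡ A@(lp s p) B E i = begin
  coeff (A ⊗ (B ⊕ E)) i                                        ≡⟨ coeff-⊗ s p (B ⊕ E) i ⟩
  act p (coeff (B ⊕ E)) (i ℤ.- s)                              ≡⟨ act-cong p (coeff-⊕ B E) _ ⟩
  act p (λ x → coeff B x ℤ.+ coeff E x) (i ℤ.- s)              ≡⟨ act-+ p (coeff B) (coeff E) _ ⟩
  act p (coeff B) (i ℤ.- s) ℤ.+ act p (coeff E) (i ℤ.- s)      ≡⟨ sym (cong₂ ℤ._+_ (coeff-⊗ s p B i) (coeff-⊗ s p E i)) ⟩
  coeff (A ⊗ B) i ℤ.+ coeff (A ⊗ E) i                          ≡⟨ sym (coeff-⊕ (A ⊗ B) (A ⊗ E) i) ⟩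
  coeff ((A ⊗ B) ⊕ (A ⊗ E)) i                                  ∎

⊕-cong : ∀ {A A′ B B′} → A ≈L A′ → B ≈L B′ → A ⊕ B ≈L A′ ⊕ B′
⊕-cong {A} {A′} {B} {B′} e e′ i =
  trans (coeff-⊕ A B i) (trans (cong₂ ℤ._+_ (e i) (e′ i)) (sym (coeff-⊕ A′ B′ i)))

⊕-assoc : ∀ A B E → (A ⊕ B) ⊕ E ≈L A ⊕ (B ⊕ E)
⊕-assoc A B E i = begin
  coeff ((A ⊕ B) ⊕ E) i                        ≡⟨ coeff-⊕ (A ⊕ B) E i ⟩
  coeff (A ⊕ B) i ℤ.+ coeff E i                ≡⟨ cong (ℤ._+ coeff E i) (coeff-⊕ A B i) ⟩
  coeff A i ℤ.+ coeff B i ℤ.+ coeff E i        ≡⟨ ℤ.+-assoc (coeff A i) _ _ ⟩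
  coeff A i ℤ.+ (coeff B i ℤ.+ coeff E i)      ≡⟨ cong (ℤ._+_ (coeff A i)) (sym (coeff-⊕ B E i)) ⟩
  coeff A i ℤ.+ coeff (B ⊕ E) i                ≡⟨ sym (coeff-⊕ A (B ⊕ E) i) ⟩
  coeff (A ⊕ (B ⊕ E)) i                        ∎

⊕-comm : ∀ A B → A ⊕ B ≈L B ⊕ A
⊕-comm A B i = trans (coeff-⊕ A B i) (trans (ℤ.+-comm (coeff A i) _) (sym (coeff-⊕ B A i)))

0L 1L : Laurent
0L = const ℤ.0ℤ
1L = const ℤ.1ℤ

coeff-0L : ∀ i → coeff 0L i ≡ ℤ.0ℤ
coeff-0L i = trans (coeff-at ℤ.0ℤ _ i) (lem (i ℤ.- ℤ.0ℤ))
  where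
  lem : ∀ i → at (ℤ.0ℤ ∷ []) i ≡ ℤ.0ℤ
  lem (+ zero) = refl
  lem (+ suc n) = refl
  lem -[1+ n ] = refl

⊕-identityˡ : ∀ A → 0L ⊕ A ≈L A
⊕-identityˡ A i = trans (coeff-⊕ 0L A i) (trans (cong (ℤ._+ coeff A i) (coeff-0L i)) (ℤ.+-identityˡ _))

⊖-inverseʳ : ∀ A → A ⊕ (⊖ A) ≈L 0L
⊖-inverseʳ A i = begin
  coeff (A ⊕ (⊖ A)) i                ≡⟨ coeff-⊕ A (⊖ A) i ⟩
  coeff A i ℤ.+ coeff (⊖ A) i        ≡⟨ cong (ℤ._+_ (coeff A i)) (coeff-⊖ A i) ⟩
  coeff A i ℤ.+ ℤ.- coeff A i        ≡⟨ ℤ.+-inverseʳ (coeff A i) ⟩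
  ℤ.0ℤ                                 ≡⟨ sym (coeff-0L i) ⟩
  coeff 0L i                         ∎

⊖-cong : ∀ {A B} → A ≈L B → ⊖ A ≈L ⊖ B
⊖-cong {A} {B} e i = trans (coeff-⊖ A i) (trans (cong ℤ.-_ (e i)) (sym (coeff-⊖ B i)))

⊗-identityˡ : ∀ A → 1L ⊗ A ≈L A
⊗-identityˡ A i = trans (coeff-⊗ ℤ.0ℤ (ℤ.1ℤ ∷ []) A i)
  (trans (ℤ.+-identityʳ _) (trans (ℤ.*-identityˡ _) (cong (coeff A) (ℤ.+-identityʳ i))))

laurentRing : CommutativeRing 0ℓ 0ℓ
laurentRing = record
  { Carrier = Laurent ; _≈_ = _≈L_ ; _+_ = _⊕_ ; _*_ = _⊗_ ; -_ = ⊖_ ; 0# = 0L ; 1# = 1L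
  ; isCommutativeRing = record
    { isRing = record
      { +-isAbelianGroup = record
        { isGroup = record
          { isMonoid = record
            { isSemigroup = record
              { isMagma = record
                { isEquivalence = record
                  { refl = λ i → refl
                  ; sym = λ e i → sym (e i)
                  ; trans = λ e e′ i → trans (e i) (e′ i) }
                ; ∙-cong = λ {A} {A′} {B} {B′} → ⊕-cong {A} {A′} {B} {B′} }
              ; assoc = ⊕-assoc }
            ; identity = ⊕-identityˡ , λ A i → trans (⊕-comm A 0L i) (⊕-identityˡ A i) }
          ; inverse = (λ A i → trans (⊕-comm (⊖ A) A i) (⊖-inverseʳ A i)) , ⊖-inverseʳ
          ; ⁻¹-cong = λ {A} {B} → ⊖-cong {A} {B} }
        ; comm = ⊕-comm }
      ; *-cong = λ {A} {A′} {B} {B′} → ⊗-cong {A} {A′} {B} {B′}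
      ; *-assoc = ⊗-assoc
      ; *-identity = ⊗-identityˡ , λ A i → trans (⊗-comm A 1L i) (⊗-identityˡ A i)
      ; distrib = ⊗-distribˡ , λ A B E i → trans (⊗-comm (B ⊕ E) A i) (trans (⊗-distribˡ A B E i)
          (⊕-cong {A ⊗ B} {B ⊗ A} {A ⊗ E} {E ⊗ A} (⊗-comm A B) (⊗-comm A E) i)) }
    ; *-comm = ⊗-comm } }

-- Cancelling a q-integer

-- This is (1 - q)[n] = 1 - q^n for operators, with the negative terms moved across.
act-qint : ∀ n f i → act (replicate n ℤ.1ℤ) f i ℤ.+ f (i ℤ.- + n) ≡ f i ℤ.+ act (replicate n ℤ.1ℤ) f (i ℤ.- ℤ.1ℤ)
act-qint zero f i = trans (ℤ.+-identityˡ _) (trans (cong f (ℤ.+-identityʳ i)) (sym (ℤ.+-identityʳ _)))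
act-qint (suc n) f i = begin
  ℤ.1ℤ ℤ.* f i ℤ.+ act r f (i ℤ.- ℤ.1ℤ) ℤ.+ f (i ℤ.- + suc n)
    ≡⟨ cong (λ x → ℤ.1ℤ ℤ.* f i ℤ.+ act r f (i ℤ.- ℤ.1ℤ) ℤ.+ f x) (lem i (+ n)) ⟩
  ℤ.1ℤ ℤ.* f i ℤ.+ act r f (i ℤ.- ℤ.1ℤ) ℤ.+ f (i ℤ.- ℤ.1ℤ ℤ.- + n)
    ≡⟨ trans (ℤ.+-assoc (ℤ.1ℤ ℤ.* f i) _ _) (cong (ℤ._+ (act r f (i ℤ.- ℤ.1ℤ) ℤ.+ f (i ℤ.- ℤ.1ℤ ℤ.- + n))) (ℤ.*-identityˡ (f i))) ⟩
  f i ℤ.+ (act r f (i ℤ.- ℤ.1ℤ) ℤ.+ f (i ℤ.- ℤ.1ℤ ℤ.- + n))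
    ≡⟨ cong (ℤ._+_ (f i)) (trans (act-qint n f (i ℤ.- ℤ.1ℤ)) (cong (ℤ._+ act r f (i ℤ.- ℤ.1ℤ ℤ.- ℤ.1ℤ)) (sym (ℤ.*-identityˡ (f (i ℤ.- ℤ.1ℤ)))))) ⟩
  f i ℤ.+ act (replicate (suc n) ℤ.1ℤ) f (i ℤ.- ℤ.1ℤ) ∎
  where
  r = replicate n ℤ.1ℤ
  lem : ∀ i n → i ℤ.- (ℤ.1ℤ ℤ.+ n) ≡ i ℤ.- ℤ.1ℤ ℤ.- n
  lem = solve-∀

-- [n+1] A = 0 makes the coefficient function of A (n+1)-periodic, and it vanishes far to the left.
qint-cancel : ∀ n A → qint (suc n) ⊗ A ≈L 0L → A ≈L 0L
qint-cancel n A@(lp s p) e i = begin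
  coeff A i          ≡⟨ coeff-at s p i ⟩
  at p (i ℤ.- s)     ≡⟨ vanish (i ℤ.- s) ⟩
  ℤ.0ℤ                 ≡⟨ sym (coeff-0L i) ⟩
  coeff 0L i         ∎
  where
  r = replicate (suc n) ℤ.1ℤ
  null : ∀ i → act r (coeff A) i ≡ ℤ.0ℤ
  null i = trans (cong (act r (coeff A)) (sym (ℤ.+-identityʳ i)))
    (trans (sym (coeff-⊗ ℤ.0ℤ r A i)) (trans (e i) (coeff-0L i)))
  periodic : ∀ i → coeff A (i ℤ.- + suc n) ≡ coeff A i
  periodic i = begin
    coeff A (i ℤ.- + suc n)                             ≡⟨ sym (ℤ.+-identityˡ _) ⟩
    ℤ.0ℤ ℤ.+ coeff A (i ℤ.- + suc n)                      ≡⟨ cong (ℤ._+ coeff A (i ℤ.- + suc n)) (sym (null i)) ⟩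
    act r (coeff A) i ℤ.+ coeff A (i ℤ.- + suc n)       ≡⟨ act-qint (suc n) (coeff A) i ⟩
    coeff A i ℤ.+ act r (coeff A) (i ℤ.- ℤ.1ℤ)            ≡⟨ cong (ℤ._+_ (coeff A i)) (null (i ℤ.- ℤ.1ℤ)) ⟩
    coeff A i ℤ.+ ℤ.0ℤ                                    ≡⟨ ℤ.+-identityʳ _ ⟩
    coeff A i                                           ∎
  lem₁ : ∀ x s → x ≡ x ℤ.+ s ℤ.- s
  lem₁ = solve-∀
  lem₂ : ∀ x s n → x ℤ.+ s ℤ.- n ℤ.- s ≡ x ℤ.- n
  lem₂ = solve-∀
  at-periodic : ∀ x → at p x ≡ at p (x ℤ.- + suc n)
  at-periodic x = begin
    at p x                                   ≡⟨ cong (at p) (lem₁ x s) ⟩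
    at p (x ℤ.+ s ℤ.- s)                     ≡⟨ sym (coeff-at s p (x ℤ.+ s)) ⟩
    coeff A (x ℤ.+ s)                        ≡⟨ sym (periodic (x ℤ.+ s)) ⟩
    coeff A (x ℤ.+ s ℤ.- + suc n)            ≡⟨ coeff-at s p (x ℤ.+ s ℤ.- + suc n) ⟩
    at p (x ℤ.+ s ℤ.- + suc n ℤ.- s)         ≡⟨ cong (at p) (lem₂ x s (+ suc n)) ⟩
    at p (x ℤ.- + suc n)                     ∎
  -- `m` only bounds the recursion: a shift by one period lowers x strictly, and after finitely many
  -- shifts x is negative.
  below : ∀ m x → x ℤ.< + m → at p x ≡ ℤ.0ℤ
  below m -[1+ _ ] _ = refl
  below (suc m) (+ x) (ℤ.+<+ (ℕ.s≤s x≤m)) = trans (at-periodic (+ x)) (below m _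
    (ℤ.<-≤-trans (subst (ℤ._< + x) (sym (ℤ.m-n≡m⊖n x (suc n))) (ℤ.m⊖1+n<m x (suc n))) (ℤ.+≤+ x≤m)))
  vanish : ∀ x → at p x ≡ ℤ.0ℤ
  vanish (+ x) = below (suc x) (+ x) (ℤ.+<+ ℕ.≤-refl)
  vanish -[1+ _ ] = refl

-- Specialisation to Laurent polynomials

open import Algebra.Properties.Semiring.Exp (CommutativeRing.semiring laurentRing) using (_^_)
open import Algebra.Properties.Semiring.Divisibility (CommutativeRing.semiring laurentRing) using (_∣_; _,_)
open import Data.Fin using (zero; suc; fromℕ; toℕ)
open import Data.Nat using (_+_; _*_; _⊓_)
open import Data.Integer using (-_; _-_)

qL hL : Laurent
qL = qpow ℤ.1ℤ
hL = qL ⊝ 1L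

open QCalculus laurentRing hL

-- The calculus takes h as its datum and sets q = 1 + h, so the indeterminate is recovered only up
-- to equality of coefficients.
q≈qL : q ≈L qL
q≈qL i = begin
  coeff (1L ⊕ (qL ⊝ 1L)) i                                         ≡⟨ coeff-⊕ 1L (qL ⊝ 1L) i ⟩
  coeff 1L i ℤ.+ coeff (qL ⊝ 1L) i                                 ≡⟨ cong (ℤ._+_ (coeff 1L i)) (trans (coeff-⊕ qL (⊖ 1L) i) (cong (ℤ._+_ (coeff qL i)) (coeff-⊖ 1L i))) ⟩
  coeff 1L i ℤ.+ (coeff qL i ℤ.+ ℤ.- coeff 1L i)                   ≡⟨ lem (coeff 1L i) (coeff qL i) ⟩
  coeff qL i                                                       ∎
  where
  lem : ∀ x y → x ℤ.+ (y ℤ.+ ℤ.- x) ≡ y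
  lem = solve-∀

coeff-qpow-⊗ : ∀ e A i → coeff (qpow e ⊗ A) i ≡ coeff A (i - e)
coeff-qpow-⊗ e A i = trans (coeff-⊗ e (ℤ.1ℤ ∷ []) A i) (trans (ℤ.+-identityʳ _) (ℤ.*-identityˡ _))

q^≈qpow : ∀ n → q ^ n ≈L qpow (+ n)
q^≈qpow zero i = refl
q^≈qpow (suc n) = ⊗-cong {q} {qL} {q ^ n} {qpow (+ n)} q≈qL (q^≈qpow n)

coeff-fromPoly : ∀ p i → coeff (fromPoly p) i ≡ at p i
coeff-fromPoly p i = trans (coeff-at ℤ.0ℤ p i) (cong (at p) (ℤ.+-identityʳ i))

fromPoly-∷ : ∀ a p → fromPoly (a ∷ p) ≈L const a ⊕ (qL ⊗ fromPoly p)
fromPoly-∷ a p i = begin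
  coeff (fromPoly (a ∷ p)) i                                  ≡⟨ coeff-fromPoly (a ∷ p) i ⟩
  at (a ∷ p) i                                                ≡⟨ at-∷ a p i ⟩
  a ℤ.* δ i ℤ.+ at p (i - ℤ.1ℤ)                                 ≡⟨ cong₂ ℤ._+_ (sym const-a) (sym (trans (coeff-qpow-⊗ ℤ.1ℤ (fromPoly p) i) (coeff-fromPoly p (i - ℤ.1ℤ)))) ⟩
  coeff (const a) i ℤ.+ coeff (qL ⊗ fromPoly p) i             ≡⟨ coeff-⊕ (const a) _ i ⟨
  coeff (const a ⊕ (qL ⊗ fromPoly p)) i                       ∎
  where
  const-a : coeff (const a) i ≡ a ℤ.* δ i
  const-a = trans (coeff-fromPoly (a ∷ []) i) (trans (at-∷ a [] i) (trans (cong (ℤ._+_ (a ℤ.* δ i)) (at-[] (i - ℤ.1ℤ))) (ℤ.+-identityʳ _)))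

fromPoly-padd : ∀ p p′ → fromPoly (padd p p′) ≈L fromPoly p ⊕ fromPoly p′
fromPoly-padd p p′ i = begin
  coeff (fromPoly (padd p p′)) i                       ≡⟨ coeff-fromPoly (padd p p′) i ⟩
  at (padd p p′) i                                     ≡⟨ at-padd p p′ i ⟩
  at p i ℤ.+ at p′ i                                   ≡⟨ cong₂ ℤ._+_ (coeff-fromPoly p i) (coeff-fromPoly p′ i) ⟨
  coeff (fromPoly p) i ℤ.+ coeff (fromPoly p′) i       ≡⟨ coeff-⊕ (fromPoly p) (fromPoly p′) i ⟨
  coeff (fromPoly p ⊕ fromPoly p′) i                   ∎

fromPoly-pshift : ∀ n p → fromPoly (pshift n p) ≈L qpow (+ n) ⊗ fromPoly p
fromPoly-pshift n p i = begin
  coeff (fromPoly (pshift n p)) i     ≡⟨ coeff-fromPoly (pshift n p) i ⟩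
  at (pshift n p) i                   ≡⟨ at-pshift n p i ⟩
  at p (i - + n)                      ≡⟨ coeff-fromPoly p (i - + n) ⟨
  coeff (fromPoly p) (i - + n)        ≡⟨ coeff-qpow-⊗ (+ n) (fromPoly p) i ⟨
  coeff (qpow (+ n) ⊗ fromPoly p) i   ∎

fromPoly-[] : fromPoly [] ≈L 0L
fromPoly-[] i = trans (coeff-fromPoly [] i) (trans (at-[] i) (sym (coeff-0L i)))

qint≈ : ∀ n → qint n ≈L [ n ]
qint≈ zero = fromPoly-[]
qint≈ (suc n) i = trans (fromPoly-∷ ℤ.1ℤ (replicate n ℤ.1ℤ) i)
  (⊕-cong {1L} {1L} {qL ⊗ qint n} {q ⊗ [ n ]} (λ _ → refl)
    (⊗-cong {qL} {q} {qint n} {[ n ]} (λ i → sym (q≈qL i)) (qint≈ n)) i)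

qbin≈ : ∀ n k → qbin n (+ k) ≈L bin n k
qbin≈ n zero i = refl
qbin≈ zero (suc k) = fromPoly-[]
qbin≈ (suc n) (suc k) i = trans (fromPoly-padd (qbinP n k) _ i)
  (⊕-cong {qbin n (+ k)} {bin n k} {fromPoly (pshift (suc k) (qbinP n (suc k)))} {q ^ suc k ⊗ bin n (suc k)} (qbin≈ n k)
    (λ i → trans (fromPoly-pshift (suc k) (qbinP n (suc k)) i)
      (⊗-cong {qpow (+ suc k)} {q ^ suc k} {qbin n (+ suc k)} {bin n (suc k)} (λ i → sym (q^≈qpow (suc k) i)) (qbin≈ n (suc k)) i)) i)

pL : Laurent
pL = qpow ℤ.-1ℤ

p^≈qpow : ∀ n → pL ^ n ≈L qpow (- + n)
p^≈qpow zero i = refl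
p^≈qpow (suc n) i = trans (⊗-cong {pL} {pL} {pL ^ n} {qpow (- + n)} (λ _ → refl) (p^≈qpow n) i)
  (cong (λ e → coeff (qpow e) i) (lem (+ n)))
  where
  lem : ∀ n → ℤ.-1ℤ ℤ.+ - n ≡ - (ℤ.1ℤ ℤ.+ n)
  lem = solve-∀

qpow≈ : ∀ m n → qpow (+ m - + n) ≈L q ^ m ⊗ pL ^ n
qpow≈ m n = ⊗-cong {qpow (+ m)} {q ^ m} {qpow (- + n)} {pL ^ n} (λ i → sym (q^≈qpow m i)) (λ i → sym (p^≈qpow n i))

q*p≈1 : q ⊗ pL ≈L 1L
q*p≈1 = ⊗-cong {q} {qL} {pL} {pL} q≈qL (λ _ → refl)

[]-cancelL : ∀ n A → [ suc n ] ⊗ A ≈L 0L → A ≈L 0L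
[]-cancelL n A e = qint-cancel n A (λ i → trans (⊗-cong {qint (suc n)} {[ suc n ]} {A} {A} (qint≈ (suc n)) (λ _ → refl) i) (e i))

open Base []-cancelL pL q*p≈1
open Transfer qint qint≈ qbin qbin≈ (λ n k i → refl) qpow qpow≈

-- Powers, sums and products of the statement

^L≡^ : ∀ A n → A ^L n ≡ A ^ n
^L≡^ A zero = refl
^L≡^ A (suc n) = cong (A ⊗_) (^L≡^ A n)

sumTo≡∑ : ∀ n {f g} → (∀ k → f k ≡ g k) → sumTo n f ≡ ∑ n g
sumTo≡∑ zero e = e 0
sumTo≡∑ (suc n) e = cong₂ _⊕_ (sumTo≡∑ n e) (e (suc n))

prodFin≡∏ : ∀ m f → prodFin m f ≡ ∏ m f
prodFin≡∏ zero f = refl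
prodFin≡∏ (suc m) f = cong (f zero ⊗_) (prodFin≡∏ m (λ i → f (suc i)))

-- The cyclic successor of an index

nextFin-inject₁ : ∀ {m} (i : Fin m) → nextFin (Fin.inject₁ i) ≡ suc i
nextFin-inject₁ {m} i = Fin.toℕ-injective (begin
  toℕ (nextFin (Fin.inject₁ i))        ≡⟨ Fin.toℕ-fromℕ< (m%n<n (suc (toℕ (Fin.inject₁ i))) (suc m)) ⟩
  suc (toℕ (Fin.inject₁ i)) % suc m    ≡⟨ cong (λ x → suc x % suc m) (Fin.toℕ-inject₁ i) ⟩
  suc (toℕ i) % suc m                  ≡⟨ m<n⇒m%n≡m (s≤s (Fin.toℕ<n i)) ⟩
  suc (toℕ i)                          ∎)

nextFin-fromℕ : ∀ m → nextFin (fromℕ m) ≡ zero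
nextFin-fromℕ m = Fin.toℕ-injective (begin
  toℕ (nextFin (fromℕ m))          ≡⟨ Fin.toℕ-fromℕ< (m%n<n (suc (toℕ (fromℕ m))) (suc m)) ⟩
  suc (toℕ (fromℕ m)) % suc m      ≡⟨ cong (λ x → suc x % suc m) (Fin.toℕ-fromℕ m) ⟩
  suc m % suc m                    ≡⟨ n%n≡0 (suc m) ⟩
  0                                ∎)

∣⇒≡0mod : ∀ {A A′ M M′} → A′ ≡ A → M′ ≡ M → M ∣ A → A′ ≡ const ℤ.0ℤ mod M′
∣⇒≡0mod {A} {M = M} refl refl (E , e) = E , λ i → begin
  coeff (A ⊝ 0L) i                       ≡⟨ coeff-⊕ A (⊖ 0L) i ⟩
  coeff A i ℤ.+ coeff (⊖ 0L) i           ≡⟨ cong (ℤ._+_ (coeff A i)) (trans (coeff-⊖ 0L i) (cong (ℤ.-_) (coeff-0L i))) ⟩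
  coeff A i ℤ.+ ℤ.0ℤ                     ≡⟨ ℤ.+-identityʳ _ ⟩
  coeff A i                              ≡⟨ e i ⟨
  coeff (E ⊗ M) i                        ∎

-- Both sides of the congruences, with the power and product operations left open: those of Defs and those of
-- the ring structure agree only propositionally.
module Sides (m : ℕ) (n : Fin (suc m) → ℕ) (j r : ℕ)
  (pow : Laurent → ℕ → Laurent) (prod : ∀ m → (Fin m → Laurent) → Laurent) where

  tailFactors : ℕ → Laurent → Laurent
  tailFactors k x = x ⊗ pow (qint k) r ⊗ pow (qint (k + 1)) r
    ⊗ prod (suc m) (λ i → qbin (n i + n (nextFin i) + 1) (+ n i - + k))

  summand₁ summand₂ : ℕ → Laurent
  summand₁ k = tailFactors k (qpow (+ (j * (k * k + k)) - + ((r + 1) * k)) ⊗ qint (2 * k + 1))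
  summand₂ k = tailFactors k (pow (const (- + 1)) k ⊗ qpow (+ (k C 2 + j * (k * k + k)) - + (r * k)) ⊗ qint (2 * k + 1))

  divisor : ℕ → ℕ → Laurent
  divisor e f = qint (n zero + n (fromℕ m) + 1) ⊗ qbin (n zero + n (fromℕ m)) (+ n zero)
    ⊗ pow (qint (n zero)) e ⊗ pow (qint (n (fromℕ m))) f

module Agreement (m : ℕ) (n : Fin (suc m) → ℕ) (j r : ℕ) where
  module F = Sides m n j r _^L_ prodFin
  module G = Sides m n j r _^_ ∏

  tailFactors≡ : ∀ k x y → x ≡ y → F.tailFactors k x ≡ G.tailFactors k y
  tailFactors≡ k x .x refl = cong₂ _⊗_ (cong₂ (λ u v → x ⊗ u ⊗ v) (^L≡^ (qint k) r) (^L≡^ (qint (k + 1)) r))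
    (prodFin≡∏ (suc m) (λ i → qbin (n i + n (nextFin i) + 1) (+ n i - + k)))

  summand₁≡ : ∀ k → F.summand₁ k ≡ G.summand₁ k
  summand₁≡ k = tailFactors≡ k (qpow (+ (j * (k * k + k)) - + ((r + 1) * k)) ⊗ qint (2 * k + 1)) _ refl

  summand₂≡ : ∀ k → F.summand₂ k ≡ G.summand₂ k
  summand₂≡ k = tailFactors≡ k (sign (const (- + 1) ^L k)) (sign (const (- + 1) ^ k)) (cong sign (^L≡^ (const (- + 1)) k))
    where
    sign : Laurent → Laurent
    sign x = x ⊗ qpow (+ (k C 2 + j * (k * k + k)) - + (r * k)) ⊗ qint (2 * k + 1)

  divisor≡ : ∀ e f → F.divisor e f ≡ G.divisor e f
  divisor≡ e f = cong₂ (λ u v → qint (n zero + n (fromℕ m) + 1) ⊗ qbin (n zero + n (fromℕ m)) (+ n zero) ⊗ u ⊗ v)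
    (^L≡^ (qint (n zero)) e) (^L≡^ (qint (n (fromℕ m))) f)

  inner : ∀ i → n (nextFin (Fin.inject₁ i)) ≡ n (suc i)
  inner i = cong n (nextFin-inject₁ i)

  last : n (nextFin (fromℕ m)) ≡ n zero
  last = cong n (nextFin-fromℕ m)

  congruence₁ : j ≤ suc m → sumTo (n zero) F.summand₁ ≡ const ℤ.0ℤ mod F.divisor (1 ⊓ r) (1 ⊓ (r C 2))
  congruence₁ j≤ = ∣⇒≡0mod {∑ (n zero) G.summand₁} {_} {G.divisor (1 ⊓ r) (1 ⊓ (r C 2))}
    (sumTo≡∑ (n zero) summand₁≡) (divisor≡ (1 ⊓ r) (1 ⊓ (r C 2)))
    (transfer₁ m n (λ i → n (nextFin i)) inner last j r j≤)

  congruence₂ : j ≤ suc m → sumTo (n zero) F.summand₂ ≡ const ℤ.0ℤ mod F.divisor (1 ⊓ r) (1 ⊓ r)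
  congruence₂ j≤ = ∣⇒≡0mod {∑ (n zero) G.summand₂} {_} {G.divisor (1 ⊓ r) (1 ⊓ r)}
    (sumTo≡∑ (n zero) summand₂≡) (divisor≡ (1 ⊓ r) (1 ⊓ r))
    (transfer₂ m n (λ i → n (nextFin i)) inner last j r j≤)

theorem1p2 : (m′ : ℕ) → (n : Fin (suc m′) → ℕ) → (∀ i → 1 ≤ n i) → (j r : ℕ) → j ≤ suc m′ →
    ((sumTo (n zero) (λ k →
    qpow (+ (j * (k * k + k)) - + ((r + 1) * k)) ⊗ qint (2 * k + 1) ⊗ (qint k ^L r) ⊗ (qint (k + 1) ^L r)
    ⊗ prodFin (suc m′) (λ i → qbin (n i + n (nextFin i) + 1) (+ n i - + k))))
    ≡ const (+ 0) mod
    (qint (n zero + n (fromℕ m′) + 1) ⊗ qbin (n zero + n (fromℕ m′)) (+ n zero)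
    ⊗ (qint (n zero) ^L (1 ⊓ r)) ⊗ (qint (n (fromℕ m′)) ^L (1 ⊓ (r C 2)))))
    ×
    ((sumTo (n zero) (λ k →
    (const (- + 1) ^L k) ⊗ qpow (+ (k C 2 + j * (k * k + k)) - + (r * k)) ⊗ qint (2 * k + 1) ⊗ (qint k ^L r) ⊗ (qint (k + 1) ^L r)
    ⊗ prodFin (suc m′) (λ i → qbin (n i + n (nextFin i) + 1) (+ n i - + k))))
    ≡ const (+ 0) mod
    (qint (n zero + n (fromℕ m′) + 1) ⊗ qbin (n zero + n (fromℕ m′)) (+ n zero)
    ⊗ (qint (n zero) ^L (1 ⊓ r)) ⊗ (qint (n (fromℕ m′)) ^L (1 ⊓ r))))
theorem1p2 m′ n _ j r j≤ = congruence₁ j≤ , congruence₂ j≤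
  where open Agreement m′ n j r
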